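{- For $k\ge 2$ and $m\ge 3$, let $G_{k,m}=(P_m)^{\square k}$ be the $k$-dimensional grid of side-length $m$, with $m^k$ vertices. Then $$\mathrm{rw}(G_{k,m})\;\ge\;\frac{e\ln 3}{12}\cdot\frac{m^{k-1}}{k}.$$
   Context: $P_m$ is the path on $m$ vertices, and $H^{\square k}$ is the $k$-th Cartesian power of $H$: its vertices are $k$-tuples of vertices of $H$, two being adjacent iff they differ in exactly one coordinate and are adjacent in $H$ in that coordinate. Rank-width: for a graph $G=(V,E)$ and $X\subseteq V$, the cut-rank $\rho_G(X)$ is the $\mathbb F_2$-rank of the $0$-$1$ adjacency matrix with rows indexed by $X$ and columns by $V\setminus X$. A rank-decomposition is a pair $(T,L)$ with $T$ a tree with at least two nodes, all of degree 1 or 3, and $L$ a bijection from $V$ to the leaves of $T$; its width is the maximum over edges $e$ of $T$ of $\rho_G$ of the vertex set corresponding to one side of $T-e$. $\mathrm{rw}(G)$ is the minimum width of a rank-decomposition of $G$. -}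

module Defs where

open import Algebra.Bundles using (CommutativeRing)
import Algebra.Properties.AbelianGroup as AbelianGroupProperties
import Algebra.Properties.CommutativeMonoid.Sum as CommutativeMonoidSum
open import Data.Bool.Base using (Bool; true; false; _∧_)
import Data.Bool.Properties as Bool
open import Data.Empty using (⊥)
open import Data.Fin.Base using (Fin; toℕ; finToFun)
open import Data.Fin.Properties using (all?; any?) renaming (_≟_ to _≟ᶠ_)
open import Data.Fin.Subset using (Subset; inside; outside; _∈_; _⊆_; Nonempty; ∣_∣; ∁)
open import Data.Fin.Subset.Properties using (_∈?_; _⊆?_; nonempty?; anySubset?)
open import Data.Integer.Base as ℤ using (+_)
import Data.Integer.Properties as ℤ
open import Data.List.Base using (List; []; _∷_; [_]; _++_; map; filter; length; allFin; cartesianProduct)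
open import Data.List.Extrema.Nat using (max)
open import Data.List.Membership.Propositional using () renaming (_∈_ to _∈ˡ_)
open import Data.List.Membership.Propositional.Properties using (∈-allFin)
open import Data.List.Relation.Unary.Any using (here; there)
open import Data.List.Relation.Unary.Linked using (Linked)
open import Data.List.Relation.Unary.Unique.Propositional using (Unique)
open import Data.Nat.Base as ℕ using (ℕ; zero; suc; _!)
import Data.Nat.Properties as ℕ
open import Data.Nat.Tactic.RingSolver using (solve-∀)
open import Data.Product.Base using (Σ; ∃-syntax; _×_; _,_; proj₁)
open import Data.Rational.Base as ℚ using (ℚ; 0ℚ; 1ℚ; _/_)
import Data.Rational.Properties as ℚ
import Data.Rational.Unnormalised.Base as ℚᵘ
import Data.Rational.Unnormalised.Properties as ℚᵘ
open import Data.Sum.Base using (_⊎_; inj₁; inj₂; swap)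
open import Data.Vec.Base as Vec using (lookup; tabulate)
open import Function.Base using (_∘_)
open import Function.Bundles using (_⤖_; Bijection)
open import Level using (0ℓ)
open import Relation.Binary.Construct.Closure.ReflexiveTransitive using (Star; ε; _◅_; _◅◅_)
open import Relation.Binary.Core using (Rel)
open import Relation.Binary.Definitions using (Decidable; Symmetric)
open import Relation.Binary.PropositionalEquality
  using (_≡_; _≢_; refl; sym; trans; cong; cong₂; subst; subst₂; module ≡-Reasoning)
open import Relation.Nullary using (¬_; Dec; does; ¬?)
open import Relation.Nullary.Decidable using (map′; _×-dec_; _⊎-dec_; _→-dec_)

-- A real number is the limit of its Cauchy sequence; equality of limits is not imposed as _≡_.
record ℝ : Set where
  field
    seq    : ℕ → ℚ
    cauchy : ∀ δ → 0ℚ ℚ.< δ →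
             ∃[ N ] (∀ i j → N ℕ.≤ i → N ℕ.≤ j → ℚ.∣ seq i ℚ.- seq j ∣ ℚ.≤ δ)

open ℝ public

infix  4 _≤ᴿ_
infixl 7 _*ᴿ_

-- lim x ≤ lim y.
_≤ᴿ_ : Rel ℝ 0ℓ
x ≤ᴿ y = ∀ δ → 0ℚ ℚ.< δ → ∃[ N ] (∀ i → N ℕ.≤ i → seq x i ℚ.≤ seq y i ℚ.+ δ)

fromℚ : ℚ → ℝ
fromℚ q = record
  { seq    = λ _ → q
  ; cauchy = λ δ 0<δ → 0 , λ _ _ _ _ →
      subst (λ p → ℚ.∣ p ∣ ℚ.≤ δ) (sym (ℚ.+-inverseʳ q)) (ℚ.<⇒≤ 0<δ)
  }

fromℕ : ℕ → ℝ
fromℕ n = fromℚ (+ n / 1)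

private
  p≡p-q+q : ∀ p q → p ≡ (p ℚ.- q) ℚ.+ q
  p≡p-q+q p q = sym (begin
    (p ℚ.- q) ℚ.+ q        ≡⟨ ℚ.+-assoc p (ℚ.- q) q ⟩
    p ℚ.+ (ℚ.- q ℚ.+ q)    ≡⟨ cong (p ℚ.+_) (ℚ.+-inverseˡ q) ⟩
    p ℚ.+ 0ℚ               ≡⟨ ℚ.+-identityʳ p ⟩
    p                      ∎)
    where open ≡-Reasoning

  pq-rs : ∀ p q r s → p ℚ.* q ℚ.- r ℚ.* s ≡ p ℚ.* (q ℚ.- s) ℚ.+ (p ℚ.- r) ℚ.* s
  pq-rs p q r s = sym (begin
    p ℚ.* (q ℚ.- s) ℚ.+ (p ℚ.- r) ℚ.* s
      ≡⟨ cong₂ ℚ._+_ (ℚ.*-distribˡ-+ p q (ℚ.- s)) (ℚ.*-distribʳ-+ s p (ℚ.- r)) ⟩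
    (p ℚ.* q ℚ.+ p ℚ.* ℚ.- s) ℚ.+ (p ℚ.* s ℚ.+ ℚ.- r ℚ.* s)
      ≡⟨ cong₂ (λ a b → (p ℚ.* q ℚ.+ a) ℚ.+ (p ℚ.* s ℚ.+ b)) (ℚ.neg-distribʳ-* p s) (ℚ.neg-distribˡ-* r s) ⟨
    (p ℚ.* q ℚ.- p ℚ.* s) ℚ.+ (p ℚ.* s ℚ.- r ℚ.* s)
      ≡⟨ ℚ.+-assoc (p ℚ.* q ℚ.- p ℚ.* s) (p ℚ.* s) (ℚ.- (r ℚ.* s)) ⟨
    ((p ℚ.* q ℚ.- p ℚ.* s) ℚ.+ p ℚ.* s) ℚ.- r ℚ.* s
      ≡⟨ cong (ℚ._- r ℚ.* s) (p≡p-q+q (p ℚ.* q) (p ℚ.* s)) ⟨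
    p ℚ.* q ℚ.- r ℚ.* s
      ∎)
    where open ≡-Reasoning

  ∣∣-mono-* : ∀ {a b c d} → ℚ.∣ a ∣ ℚ.≤ b → ℚ.∣ c ∣ ℚ.≤ d → ℚ.∣ a ℚ.* c ∣ ℚ.≤ b ℚ.* d
  ∣∣-mono-* {a} {b} {c} {d} a≤b c≤d = begin
    ℚ.∣ a ℚ.* c ∣           ≡⟨ ℚ.∣p*q∣≡∣p∣*∣q∣ a c ⟩
    ℚ.∣ a ∣ ℚ.* ℚ.∣ c ∣     ≤⟨ ℚ.*-monoʳ-≤-nonNeg ℚ.∣ c ∣ {{ℚ.∣-∣-nonNeg c}} a≤b ⟩
    b ℚ.* ℚ.∣ c ∣           ≤⟨ ℚ.*-monoˡ-≤-nonNeg b {{ℚ.nonNegative (ℚ.≤-trans (ℚ.0≤∣p∣ a) a≤b)}} c≤d ⟩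
    b ℚ.* d                 ∎
    where open ℚ.≤-Reasoning

  bounded : (x : ℝ) → ∃[ B ] (0ℚ ℚ.< B × ∃[ N ] (∀ i → N ℕ.≤ i → ℚ.∣ seq x i ∣ ℚ.≤ B))
  bounded x with cauchy x 1ℚ (ℚ.positive⁻¹ 1ℚ)
  ... | N , close = B , 0<B , N , bound
    where
    open ℚ.≤-Reasoning
    b = seq x N
    B = 1ℚ ℚ.+ ℚ.∣ b ∣
    0<B : 0ℚ ℚ.< B
    0<B = ℚ.+-mono-<-≤ (ℚ.positive⁻¹ 1ℚ) (ℚ.0≤∣p∣ b)
    bound : ∀ i → N ℕ.≤ i → ℚ.∣ seq x i ∣ ℚ.≤ B
    bound i N≤i = begin
      ℚ.∣ seq x i ∣                       ≡⟨ cong ℚ.∣_∣ (p≡p-q+q (seq x i) b) ⟩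
      ℚ.∣ (seq x i ℚ.- b) ℚ.+ b ∣         ≤⟨ ℚ.∣p+q∣≤∣p∣+∣q∣ (seq x i ℚ.- b) b ⟩
      ℚ.∣ seq x i ℚ.- b ∣ ℚ.+ ℚ.∣ b ∣     ≤⟨ ℚ.+-monoˡ-≤ ℚ.∣ b ∣ (close i N N≤i ℕ.≤-refl) ⟩
      B                                   ∎

  *-cauchy : (x y : ℝ) → ∀ δ → 0ℚ ℚ.< δ →
             ∃[ N ] (∀ i j → N ℕ.≤ i → N ℕ.≤ j →
               ℚ.∣ seq x i ℚ.* seq y i ℚ.- seq x j ℚ.* seq y j ∣ ℚ.≤ δ)
  *-cauchy x y δ 0<δ with bounded x | bounded y
  ... | A , 0<A , K , x≤A | B , 0<B , L , y≤B = go
    where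
    C = A ℚ.+ B
    instance
      C-pos : ℚ.Positive C
      C-pos = ℚ.positive (ℚ.+-mono-< 0<A 0<B)
      C-nonZero : ℚ.NonZero C
      C-nonZero = ℚ.pos⇒nonZero C
      δ-pos : ℚ.Positive δ
      δ-pos = ℚ.positive 0<δ
      1/C-pos : ℚ.Positive (ℚ.1/ C)
      1/C-pos = ℚ.1/pos⇒pos C
    η = δ ℚ.* ℚ.1/ C
    0<η : 0ℚ ℚ.< η
    0<η = ℚ.positive⁻¹ η {{ℚ.pos*pos⇒pos δ (ℚ.1/ C)}}
    Aη+ηB≡δ : A ℚ.* η ℚ.+ η ℚ.* B ≡ δ
    Aη+ηB≡δ = begin
      A ℚ.* η ℚ.+ η ℚ.* B
        ≡⟨ cong (A ℚ.* η ℚ.+_) (ℚ.*-comm η B) ⟩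
      A ℚ.* η ℚ.+ B ℚ.* η
        ≡⟨ ℚ.*-distribʳ-+ η A B ⟨
      C ℚ.* η
        ≡⟨ ℚ.*-comm C η ⟩
      (δ ℚ.* ℚ.1/ C) ℚ.* C
        ≡⟨ ℚ.*-assoc δ (ℚ.1/ C) C ⟩
      δ ℚ.* (ℚ.1/ C ℚ.* C)
        ≡⟨ cong (δ ℚ.*_) (ℚ.*-inverseˡ C) ⟩
      δ ℚ.* 1ℚ
        ≡⟨ ℚ.*-identityʳ δ ⟩
      δ ∎
      where open ≡-Reasoning
    go : ∃[ N ] (∀ i j → N ℕ.≤ i → N ℕ.≤ j →
           ℚ.∣ seq x i ℚ.* seq y i ℚ.- seq x j ℚ.* seq y j ∣ ℚ.≤ δ)
    go with cauchy x η 0<η | cauchy y η 0<η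
    ... | M , x-close | N , y-close = (K ℕ.⊔ L) ℕ.⊔ (M ℕ.⊔ N) , close
      where
      open ℚ.≤-Reasoning
      close : ∀ i j → (K ℕ.⊔ L) ℕ.⊔ (M ℕ.⊔ N) ℕ.≤ i → (K ℕ.⊔ L) ℕ.⊔ (M ℕ.⊔ N) ℕ.≤ j →
              ℚ.∣ seq x i ℚ.* seq y i ℚ.- seq x j ℚ.* seq y j ∣ ℚ.≤ δ
      close i j i≥ j≥ = begin
        ℚ.∣ p ℚ.* q ℚ.- r ℚ.* s ∣
          ≡⟨ cong ℚ.∣_∣ (pq-rs p q r s) ⟩
        ℚ.∣ p ℚ.* (q ℚ.- s) ℚ.+ (p ℚ.- r) ℚ.* s ∣
          ≤⟨ ℚ.∣p+q∣≤∣p∣+∣q∣ (p ℚ.* (q ℚ.- s)) ((p ℚ.- r) ℚ.* s) ⟩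
        ℚ.∣ p ℚ.* (q ℚ.- s) ∣ ℚ.+ ℚ.∣ (p ℚ.- r) ℚ.* s ∣
          ≤⟨ ℚ.+-mono-≤
               (∣∣-mono-* (x≤A i (ℕ.m⊔n≤o⇒m≤o K L KL≤i)) (y-close i j (ℕ.m⊔n≤o⇒n≤o M N MN≤i) (ℕ.m⊔n≤o⇒n≤o M N MN≤j)))
               (∣∣-mono-* (x-close i j (ℕ.m⊔n≤o⇒m≤o M N MN≤i) (ℕ.m⊔n≤o⇒m≤o M N MN≤j)) (y≤B j (ℕ.m⊔n≤o⇒n≤o K L KL≤j))) ⟩
        A ℚ.* η ℚ.+ η ℚ.* B
          ≡⟨ Aη+ηB≡δ ⟩
        δ ∎
        where
        p = seq x i
        q = seq y i
        r = seq x j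
        s = seq y j
        KL≤i = ℕ.m⊔n≤o⇒m≤o (K ℕ.⊔ L) (M ℕ.⊔ N) i≥
        MN≤i = ℕ.m⊔n≤o⇒n≤o (K ℕ.⊔ L) (M ℕ.⊔ N) i≥
        KL≤j = ℕ.m⊔n≤o⇒m≤o (K ℕ.⊔ L) (M ℕ.⊔ N) j≥
        MN≤j = ℕ.m⊔n≤o⇒n≤o (K ℕ.⊔ L) (M ℕ.⊔ N) j≥

_*ᴿ_ : ℝ → ℝ → ℝ
x *ᴿ y = record { seq = λ i → seq x i ℚ.* seq y i ; cauchy = *-cauchy x y }

partialSum : (ℕ → ℚ) → ℕ → ℚ
partialSum a zero    = 0ℚ
partialSum a (suc n) = partialSum a n ℚ.+ a n

_/2^_ : ℕ → ℕ → ℚ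
a /2^ n = _/_ (+ a) (2 ℕ.^ n) {{ℕ.m^n≢0 2 n}}

private
  open AbelianGroupProperties ℚ.+-0-abelianGroup using (xyx⁻¹≈y; ⁻¹-anti-homo‿-)

  toℚᵘ-/ : ∀ a b-1 → ℚ.toℚᵘ (+ a / suc b-1) ℚᵘ.≃ ℚᵘ.mkℚᵘ (+ a) b-1
  toℚᵘ-/ a b-1 = ℚ.toℚᵘ-fromℚᵘ (ℚᵘ.mkℚᵘ (+ a) b-1)

  /-mono : ∀ a b c d .{{_ : ℕ.NonZero b}} .{{_ : ℕ.NonZero d}} →
           a ℕ.* d ℕ.≤ c ℕ.* b → + a / b ℚ.≤ + c / d
  /-mono a (suc b-1) c (suc d-1) ad≤cb = ℚ.toℚᵘ-cancel-≤
    (ℚᵘ.≤-respˡ-≃ (ℚᵘ.≃-sym (toℚᵘ-/ a b-1))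
    (ℚᵘ.≤-respʳ-≃ (ℚᵘ.≃-sym (toℚᵘ-/ c d-1))
    (ℚᵘ.*≤* (subst₂ ℤ._≤_ (ℤ.pos-* a (suc d-1)) (ℤ.pos-* c (suc b-1)) (ℤ.+≤+ ad≤cb)))))

  /-+-mono : ∀ a b c d e f .{{_ : ℕ.NonZero b}} .{{_ : ℕ.NonZero d}} .{{_ : ℕ.NonZero f}} →
             (a ℕ.* d ℕ.+ c ℕ.* b) ℕ.* f ℕ.≤ e ℕ.* (b ℕ.* d) → + a / b ℚ.+ + c / d ℚ.≤ + e / f
  /-+-mono a (suc b-1) c (suc d-1) e (suc f-1) h = ℚ.toℚᵘ-cancel-≤
    (ℚᵘ.≤-respˡ-≃ (ℚᵘ.≃-sym (ℚᵘ.≃-trans (ℚ.toℚᵘ-homo-+ (+ a / suc b-1) (+ c / suc d-1))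
                                        (ℚᵘ.+-cong (toℚᵘ-/ a b-1) (toℚᵘ-/ c d-1))))
    (ℚᵘ.≤-respʳ-≃ (ℚᵘ.≃-sym (toℚᵘ-/ e f-1))
    (ℚᵘ.*≤* (subst₂ ℤ._≤_ lhs (ℤ.pos-* e (suc b-1 ℕ.* suc d-1)) (ℤ.+≤+ h)))))
    where
    open ≡-Reasoning
    lhs : + ((a ℕ.* suc d-1 ℕ.+ c ℕ.* suc b-1) ℕ.* suc f-1) ≡
          ((+ a) ℤ.* (+ suc d-1) ℤ.+ (+ c) ℤ.* (+ suc b-1)) ℤ.* (+ suc f-1)
    lhs = begin
      + ((a ℕ.* suc d-1 ℕ.+ c ℕ.* suc b-1) ℕ.* suc f-1)
        ≡⟨ ℤ.pos-* (a ℕ.* suc d-1 ℕ.+ c ℕ.* suc b-1) (suc f-1) ⟩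
      (+ (a ℕ.* suc d-1) ℤ.+ + (c ℕ.* suc b-1)) ℤ.* (+ suc f-1)
        ≡⟨ cong₂ (λ p q → (p ℤ.+ q) ℤ.* (+ suc f-1)) (ℤ.pos-* a (suc d-1)) (ℤ.pos-* c (suc b-1)) ⟩
      ((+ a) ℤ.* (+ suc d-1) ℤ.+ (+ c) ℤ.* (+ suc b-1)) ℤ.* (+ suc f-1)
        ∎

  n≤2^n : ∀ n → n ℕ.≤ 2 ℕ.^ n
  n≤2^n zero    = ℕ.z≤n
  n≤2^n (suc n) = ℕ.+-mono-≤ (ℕ.m^n>0 2 n) (ℕ.≤-trans (n≤2^n n) (ℕ.m≤m+n (2 ℕ.^ n) 0))

  4/2^-small : ∀ δ → 0ℚ ℚ.< δ → ∃[ N ] 4 /2^ N ℚ.≤ δ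
  4/2^-small (ℚ.mkℚ ℤ.-[1+ _ ] _ _) (ℚ.*<* ())
  4/2^-small (ℚ.mkℚ (+ 0)      _ _) (ℚ.*<* (ℤ.+<+ ()))
  4/2^-small δ@(ℚ.mkℚ (+ suc a) d-1 _) _ = N ,
    subst (4 /2^ N ℚ.≤_) (ℚ.↥p/↧p≡p δ)
      (/-mono 4 (2 ℕ.^ N) (suc a) (suc d-1) {{ℕ.m^n≢0 2 N}} (begin
        4 ℕ.* suc d-1               ≤⟨ ℕ.*-monoʳ-≤ 4 (n≤2^n (suc d-1)) ⟩
        4 ℕ.* 2 ℕ.^ suc d-1         ≡⟨ ℕ.*-assoc 2 2 (2 ℕ.^ suc d-1) ⟩
        2 ℕ.^ N                     ≤⟨ ℕ.m≤m+n (2 ℕ.^ N) (a ℕ.* 2 ℕ.^ N) ⟩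
        suc a ℕ.* 2 ℕ.^ N           ∎))
    where
    open ℕ.≤-Reasoning
    N = 2 ℕ.+ suc d-1

  within : ∀ s t p q → s ℚ.≤ p → p ℚ.≤ s ℚ.+ t → s ℚ.≤ q → q ℚ.≤ s ℚ.+ t → ℚ.∣ p ℚ.- q ∣ ℚ.≤ t
  within s t p q s≤p p≤s+t s≤q q≤s+t with ℚ.∣p∣≡p∨∣p∣≡-p (p ℚ.- q)
  ... | inj₁ eq = subst (ℚ._≤ t) (sym eq) (begin
      p ℚ.- q               ≤⟨ ℚ.+-mono-≤ p≤s+t (ℚ.neg-antimono-≤ s≤q) ⟩
      (s ℚ.+ t) ℚ.- s       ≡⟨ s+t-s ⟩
      t                     ∎)
    where
    open ℚ.≤-Reasoning
    s+t-s : (s ℚ.+ t) ℚ.- s ≡ t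
    s+t-s = xyx⁻¹≈y s t
  ... | inj₂ eq = subst (ℚ._≤ t) (sym eq) (begin
      ℚ.- (p ℚ.- q)         ≡⟨ ⁻¹-anti-homo‿- p q ⟩
      q ℚ.- p               ≤⟨ ℚ.+-mono-≤ q≤s+t (ℚ.neg-antimono-≤ s≤p) ⟩
      (s ℚ.+ t) ℚ.- s       ≡⟨ xyx⁻¹≈y s t ⟩
      t                     ∎)
    where open ℚ.≤-Reasoning

module _ (a : ℕ → ℚ) (0≤a : ∀ i → 0ℚ ℚ.≤ a i) (a≤2/2^ : ∀ i → a i ℚ.≤ 2 /2^ i) where

  private
    S = partialSum a

    tail-step : ∀ n → S (suc n) ℚ.+ 4 /2^ suc n ℚ.≤ S n ℚ.+ 4 /2^ n
    tail-step n = begin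
      (S n ℚ.+ a n) ℚ.+ 4 /2^ suc n      ≡⟨ ℚ.+-assoc (S n) (a n) (4 /2^ suc n) ⟩
      S n ℚ.+ (a n ℚ.+ 4 /2^ suc n)      ≤⟨ ℚ.+-monoʳ-≤ (S n) (ℚ.+-monoˡ-≤ (4 /2^ suc n) (a≤2/2^ n)) ⟩
      S n ℚ.+ (2 /2^ n ℚ.+ 4 /2^ suc n)  ≤⟨ ℚ.+-monoʳ-≤ (S n)
                                              (/-+-mono 2 B 4 (2 ℕ.* B) 4 B {{nz}} {{ℕ.m^n≢0 2 (suc n)}} {{nz}}
                                                (ℕ.≤-reflexive (arith B))) ⟩
      S n ℚ.+ 4 /2^ n                    ∎
      where
      open ℚ.≤-Reasoning
      B = 2 ℕ.^ n
      nz = ℕ.m^n≢0 2 n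
      arith : ∀ b → (2 ℕ.* (2 ℕ.* b) ℕ.+ 4 ℕ.* b) ℕ.* b ≡ 4 ℕ.* (b ℕ.* (2 ℕ.* b))
      arith = solve-∀

    0≤tail : ∀ n → 0ℚ ℚ.≤ 4 /2^ n
    0≤tail n = ℚ.nonNegative⁻¹ _ {{ℚ.normalize-nonNeg 4 (2 ℕ.^ n) {{ℕ.m^n≢0 2 n}}}}

    S-mono : ∀ {m n} → m ℕ.≤′ n → S m ℚ.≤ S n
    S-mono ℕ.≤′-refl                = ℚ.≤-refl
    S-mono {n = suc n} (ℕ.≤′-step p) = ℚ.≤-trans (S-mono p)
      (ℚ.≤-trans (ℚ.≤-reflexive (sym (ℚ.+-identityʳ (S n)))) (ℚ.+-monoʳ-≤ (S n) (0≤a n)))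

    S+tail-antimono : ∀ {m n} → m ℕ.≤′ n → S n ℚ.+ 4 /2^ n ℚ.≤ S m ℚ.+ 4 /2^ m
    S+tail-antimono ℕ.≤′-refl                 = ℚ.≤-refl
    S+tail-antimono {n = suc n} (ℕ.≤′-step p) = ℚ.≤-trans (tail-step n) (S+tail-antimono p)

    S≤ : ∀ {m n} → m ℕ.≤′ n → S n ℚ.≤ S m ℚ.+ 4 /2^ m
    S≤ {n = n} p = ℚ.≤-trans
      (ℚ.≤-trans (ℚ.≤-reflexive (sym (ℚ.+-identityʳ (S n)))) (ℚ.+-monoʳ-≤ (S n) (0≤tail n)))
      (S+tail-antimono p)

  series : ℝ
  series = record { seq = S ; cauchy = λ δ 0<δ → go δ (4/2^-small δ 0<δ) }
    where
    go : ∀ δ → ∃[ N ] 4 /2^ N ℚ.≤ δ →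
         ∃[ N ] (∀ i j → N ℕ.≤ i → N ℕ.≤ j → ℚ.∣ S i ℚ.- S j ∣ ℚ.≤ δ)
    go δ (N , 4/2^N≤δ) = N , λ i j N≤i N≤j → ℚ.≤-trans
      (within (S N) (4 /2^ N) (S i) (S j)
        (S-mono (ℕ.≤⇒≤′ N≤i)) (S≤ (ℕ.≤⇒≤′ N≤i)) (S-mono (ℕ.≤⇒≤′ N≤j)) (S≤ (ℕ.≤⇒≤′ N≤j)))
      4/2^N≤δ

1/_! : ℕ → ℚ
1/ i ! = _/_ (+ 1) (i !) {{i ℕ.!≢0}}

e : ℝ
e = series 1/_! nonNeg bound
  where
  nonNeg : ∀ i → 0ℚ ℚ.≤ 1/ i !
  nonNeg i = ℚ.nonNegative⁻¹ _ {{ℚ.normalize-nonNeg 1 (i !) {{i ℕ.!≢0}}}}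

  2^i≤2*i! : ∀ i → 2 ℕ.^ i ℕ.≤ 2 ℕ.* i !
  2^i≤2*i! 0             = ℕ.s≤s ℕ.z≤n
  2^i≤2*i! 1             = ℕ.≤-refl
  2^i≤2*i! (suc (suc i)) = ℕ.*-monoʳ-≤ 2 (ℕ.≤-trans (2^i≤2*i! (suc i))
    (ℕ.*-monoˡ-≤ (suc i !) (ℕ.s≤s (ℕ.s≤s (ℕ.z≤n {i})))))

  bound : ∀ i → 1/ i ! ℚ.≤ 2 /2^ i
  bound i = /-mono 1 (i !) 2 (2 ℕ.^ i) {{i ℕ.!≢0}} {{ℕ.m^n≢0 2 i}}
    (ℕ.≤-trans (ℕ.≤-reflexive (ℕ.*-identityˡ (2 ℕ.^ i))) (2^i≤2*i! i))

-- ln x = 2 (t + t³/3 + t⁵/5 + ⋯) where t = (x - 1) / (x + 1), so t = 1/2 for x = 3.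
ln3-denominator : ℕ → ℕ
ln3-denominator i = 2 ℕ.^ suc (2 ℕ.* i) ℕ.* suc (2 ℕ.* i)

ln3-denominator≢0 : ∀ i → ℕ.NonZero (ln3-denominator i)
ln3-denominator≢0 i =
  ℕ.m*n≢0 (2 ℕ.^ suc (2 ℕ.* i)) (suc (2 ℕ.* i)) {{ℕ.m^n≢0 2 (suc (2 ℕ.* i))}}

ln3-term : ℕ → ℚ
ln3-term i = _/_ (+ 2) (ln3-denominator i) {{ln3-denominator≢0 i}}

ln3 : ℝ
ln3 = series ln3-term nonNeg bound
  where
  nonNeg : ∀ i → 0ℚ ℚ.≤ ln3-term i
  nonNeg i = ℚ.nonNegative⁻¹ _
    {{ℚ.normalize-nonNeg 2 (ln3-denominator i) {{ln3-denominator≢0 i}}}}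

  bound : ∀ i → ln3-term i ℚ.≤ 2 /2^ i
  bound i = /-mono 2 (ln3-denominator i) 2 (2 ℕ.^ i) {{ln3-denominator≢0 i}} {{ℕ.m^n≢0 2 i}}
    (ℕ.*-monoʳ-≤ 2 (ℕ.≤-trans (ℕ.^-monoʳ-≤ 2 (ℕ.m≤n⇒m≤1+n (ℕ.m≤m+n i (i ℕ.+ 0))))
                              (ℕ.m≤m*n (2 ℕ.^ suc (2 ℕ.* i)) (suc (2 ℕ.* i)))))

record Graph (n : ℕ) : Set₁ where
  field
    Adj    : Rel (Fin n) 0ℓ
    adj?   : Decidable Adj
    symm   : Symmetric Adj
    irrefl : ∀ {u} → ¬ Adj u u

open Graph public

degree : ∀ {n} → Graph n → Fin n → ℕ
degree G u = ∣ tabulate (λ v → does (adj? G u v)) ∣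

path : ∀ m → Graph m
path m = record
  { Adj    = λ i j → toℕ j ≡ suc (toℕ i) ⊎ toℕ i ≡ suc (toℕ j)
  ; adj?   = λ i j → (toℕ j ℕ.≟ suc (toℕ i)) ⊎-dec (toℕ i ℕ.≟ suc (toℕ j))
  ; symm   = swap
  ; irrefl = λ { (inj₁ eq) → ℕ.1+n≢n (sym eq) ; (inj₂ eq) → ℕ.1+n≢n (sym eq) }
  }

-- A vertex of the k-th power of H is a code, under the bijection finToFun,
-- for a k-tuple Fin k → Fin m of vertices of H.
cartesianPower : ∀ {m} → Graph m → (k : ℕ) → Graph (m ℕ.^ k)
cartesianPower {m} H k = record
  { Adj    = λ u v → TupleAdj (finToFun u) (finToFun v)
  ; adj?   = λ u v → any? λ i → adj? H (finToFun u i) (finToFun v i) ×-dec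
                     all? λ j → ¬? (j ≟ᶠ i) →-dec (finToFun u j ≟ᶠ finToFun v j)
  ; symm   = λ { (i , adj , eq) → i , symm H adj , λ j j≢i → sym (eq j j≢i) }
  ; irrefl = λ { (i , adj , _) → irrefl H adj }
  }
  where
  TupleAdj : Rel (Fin k → Fin m) 0ℓ
  TupleAdj u v = ∃[ i ] (Adj H (u i) (v i) × (∀ j → j ≢ i → u j ≡ v j))

grid : (k m : ℕ) → Graph (m ℕ.^ k)
grid k m = cartesianPower (path m) k

deleteEdge : ∀ {n} → Graph n → Fin n → Fin n → Graph n
deleteEdge G x y = record
  { Adj    = λ u v → Adj G u v × ¬ (u ≡ x × v ≡ y ⊎ u ≡ y × v ≡ x)
  ; adj?   = λ u v → adj? G u v ×-dec
               ¬? (((u ≟ᶠ x) ×-dec (v ≟ᶠ y)) ⊎-dec ((u ≟ᶠ y) ×-dec (v ≟ᶠ x)))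
  ; symm   = λ { (adj , ≢xy) → symm G adj , λ
               { (inj₁ (v≡x , u≡y)) → ≢xy (inj₂ (u≡y , v≡x))
               ; (inj₂ (v≡y , u≡x)) → ≢xy (inj₁ (u≡x , v≡y)) } }
  ; irrefl = λ { (adj , _) → irrefl G adj }
  }

Reachable : ∀ {n} → Graph n → Rel (Fin n) 0ℓ
Reachable G = Star (Adj G)

Connected : ∀ {n} → Graph n → Set
Connected G = ∀ u v → Reachable G u v

-- The list runs once around the cycle, without repeating its starting vertex.
IsCycle : ∀ {n} → Graph n → List (Fin n) → Set
IsCycle G []       = ⊥
IsCycle G (u ∷ us) = 3 ℕ.≤ length (u ∷ us) × Unique (u ∷ us) × Linked (Adj G) (u ∷ us ++ [ u ])

record IsTree {n} (T : Graph n) : Set where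
  field
    nonempty  : 1 ℕ.≤ n
    connected : Connected T
    acyclic   : ∀ us → ¬ IsCycle T us

-- Warshall's algorithm: Via ws u v holds iff v can be reached from u by a
-- walk whose intermediate vertices all lie in ws.
module _ {n} (G : Graph n) where

  private
    Via : List (Fin n) → Rel (Fin n) 0ℓ
    Via []       u v = u ≡ v ⊎ Adj G u v
    Via (w ∷ ws) u v = Via ws u v ⊎ (Via ws u w × Via ws w v)

    via? : ∀ ws → Decidable (Via ws)
    via? []       u v = (u ≟ᶠ v) ⊎-dec adj? G u v
    via? (w ∷ ws) u v = via? ws u v ⊎-dec (via? ws u w ×-dec via? ws w v)

    via⇒reachable : ∀ ws {u v} → Via ws u v → Reachable G u v
    via⇒reachable []       (inj₁ refl)    = ε
    via⇒reachable []       (inj₂ adj)     = adj ◅ ε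
    via⇒reachable (w ∷ ws) (inj₁ p)       = via⇒reachable ws p
    via⇒reachable (w ∷ ws) (inj₂ (p , q)) = via⇒reachable ws p ◅◅ via⇒reachable ws q

    direct : ∀ ws {u v} → u ≡ v ⊎ Adj G u v → Via ws u v
    direct []       p = p
    direct (w ∷ ws) p = inj₁ (direct ws p)

    via-trans : ∀ {ws u w v} → w ∈ˡ ws → Via ws u w → Via ws w v → Via ws u v
    via-trans (here refl) p q = inj₂ (to p , from q)
      where
      to : ∀ {ws u w} → Via (w ∷ ws) u w → Via ws u w
      to (inj₁ p)       = p
      to (inj₂ (p , _)) = p
      from : ∀ {ws w v} → Via (w ∷ ws) w v → Via ws w v
      from (inj₁ q)       = q
      from (inj₂ (_ , q)) = q
    via-trans (there w∈) (inj₁ p)       (inj₁ q)       = inj₁ (via-trans w∈ p q)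
    via-trans (there w∈) (inj₁ p)       (inj₂ (q , r)) = inj₂ (via-trans w∈ p q , r)
    via-trans (there w∈) (inj₂ (p , q)) (inj₁ r)       = inj₂ (p , via-trans w∈ q r)
    via-trans (there w∈) (inj₂ (p , _)) (inj₂ (_ , r)) = inj₂ (p , r)

    reachable⇒via : ∀ {u v} → Reachable G u v → Via (allFin n) u v
    reachable⇒via ε         = direct (allFin n) (inj₁ refl)
    reachable⇒via (adj ◅ p) =
      via-trans (∈-allFin _) (direct (allFin n) (inj₂ adj)) (reachable⇒via p)

  reachable? : Decidable (Reachable G)
  reachable? u v = map′ (via⇒reachable (allFin n)) reachable⇒via (via? (allFin n) u v)

module 𝔽₂ where
  open CommutativeRing Bool.xor-∧-commutativeRing public using (+-commutativeMonoid)
  open CommutativeMonoidSum +-commutativeMonoid public using (sum)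

-- Matrices over 𝔽₂; the submatrix with rows X and columns Y is given by X and Y.
Matrix : ℕ → ℕ → Set
Matrix p q = Fin p → Fin q → Bool

module _ {p q} (A : Matrix p q) (Y : Subset q) where

  rowSum : Subset p → Fin q → Bool
  rowSum S y = 𝔽₂.sum (λ x → lookup S x ∧ A x y)

  -- Over 𝔽₂, a linear combination of rows is the sum of a set of rows.
  LinearlyIndependent : Subset p → Set
  LinearlyIndependent S =
    ¬ (∃[ R ] (R ⊆ S × Nonempty R × (∀ y → y ∈ Y → rowSum R y ≡ false)))

  linearlyIndependent? : ∀ S → Dec (LinearlyIndependent S)
  linearlyIndependent? S = ¬? (anySubset? λ R → R ⊆? S ×-dec nonempty? R ×-dec
    all? λ y → (y ∈? Y) →-dec (rowSum R y Bool.≟ false))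

subsets : ∀ n → List (Subset n)
subsets zero    = [ Vec.[] ]
subsets (suc n) = map (inside Vec.∷_) (subsets n) ++ map (outside Vec.∷_) (subsets n)

rank : ∀ {p q} → Matrix p q → Subset p → Subset q → ℕ
rank {p} A X Y =
  max 0 (map ∣_∣ (filter (λ S → S ⊆? X ×-dec linearlyIndependent? A Y S) (subsets p)))

adjacencyMatrix : ∀ {n} → Graph n → Matrix n n
adjacencyMatrix G u v = does (adj? G u v)

cutRank : ∀ {n} → Graph n → Subset n → ℕ
cutRank G X = rank (adjacencyMatrix G) X (∁ X)

Leaf : ∀ {t} → Graph t → Set
Leaf {t} T = Σ (Fin t) λ x → degree T x ≡ 1

record RankDecomposition (n : ℕ) : Set₁ where
  field
    {t}     : ℕ
    T       : Graph t
    isTree  : IsTree T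
    2≤t     : 2 ℕ.≤ t
    degrees : ∀ x → degree T x ≡ 1 ⊎ degree T x ≡ 3
    L       : Fin n ⤖ Leaf T

  leaf : Fin n → Fin t
  leaf v = proj₁ (Bijection.to L v)

  -- The vertices on the side of x after deleting the edge xy of T.
  side : Fin t × Fin t → Subset n
  side (x , y) = tabulate λ v → does (reachable? (deleteEdge T x y) x (leaf v))

  -- Every edge is listed in both directions, so both of its sides are considered.
  edges : List (Fin t × Fin t)
  edges = filter (λ { (x , y) → adj? T x y }) (cartesianProduct (allFin t) (allFin t))

  width : Graph n → ℕ
  width G = max 0 (map (cutRank G ∘ side) edges)

-- rw(G) = r: r is the minimum width of a rank-decomposition of G.
IsRankWidth : ∀ {n} → Graph n → ℕ → Set₁
IsRankWidth {n} G r =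
  (∃[ D ] RankDecomposition.width {n} D G ≡ r) × (∀ D → r ℕ.≤ RankDecomposition.width {n} D G)

{-# OPTIONS --safe #-}

-- Descending through a rank-decomposition of a graph with n vertices, one finds an edge of
-- the tree with a side X such that n / 3 ≤ |X| ≤ 2 n / 3.  For each of the 2 k directions of
-- the grid, let S be the set of vertices of X whose neighbour in that direction lies outside X.
-- Ordered by the coordinate that moves, the rows S and their neighbours form a triangular
-- matrix, so the cut-rank ρ of X is at least |S|, and the 2 k sets together have at most
-- 2 k ρ elements.  On a line of m vertices containing a vertices of X, 4 a (m - a) is at most
-- m² times the number of edges leaving X; tensorizing this inequality gives
-- 4 |X| (n - |X|) ≤ m^(k+1) · 2 k ρ with n = m^k, and hence 4 m^(k-1) ≤ 9 k ρ.  Comparison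
-- with geometric series gives e ≤ 4 and ln 3 ≤ 4 / 3, so that e ln 3 / 12 ≤ 4 / 9.

module Submission where

open import Defs
import Algebra.Properties.CommutativeMonoid.Sum as CommutativeMonoidSum
import Algebra.Properties.Semiring.Sum as SemiringSum
open import Data.Bool.Base using (Bool; true; false; _∧_; not; _xor_)
import Data.Bool.Properties as Bool
open import Data.Fin.Base
  using (Fin; zero; suc; toℕ; inject₁; pred; _↑ˡ_; _↑ʳ_; combine; punchIn; finToFun; funToFin)
open import Data.Fin.Induction using (<-weakInduction)
open import Data.Fin.Properties
  using (any?; toℕ-injective; toℕ-inject₁; toℕ<n; punchInᵢ≢i; finToFun-funToFin; funToFin-finToFin)
  renaming (_≟_ to _≟ᶠ_)
open import Data.Fin.Subset
  using (Subset; Nonempty; ∣_∣; ∁; _∈_; _∉_; _⊆_; _⊂_; ⊤; _∪_; _-_; ⁅_⁆; inside; outside)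
open import Data.Fin.Subset.Properties
  using (_⊆?_; nonempty?; Empty-unique; ∣⊥∣≡0; ∣⊤∣≡n; ∣⁅x⁆∣≡1; x∈⁅x⁆; x∈p∪q⁺; x∉p⇒x∈∁p; x∈∁p⇒x∉p;
         p⊆q⇒∣p∣≤∣q∣; p⊂q⇒∣p∣<∣q∣; x∈p∧x≢y⇒x∈p-y; x∈p⇒∣p-x∣<∣p∣; p─q⊆p; p─q─q≡p─q)
open import Data.Integer.Base as ℤ using (+_)
import Data.Integer.Properties as ℤ
open import Data.List.Base using (List; []; _∷_; [_]; _++_; map)
open import Data.List.Extrema.Nat using (max; xs≤max)
import Data.List.Membership.DecPropositional as DecMembership
open import Data.List.Membership.Propositional using () renaming (_∈_ to _∈ˡ_)
open import Data.List.Membership.Propositional.Properties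
  using (∈-map⁺; ∈-filter⁺; ∈-++⁺ˡ; ∈-++⁺ʳ; ∈-cartesianProduct⁺; ∈-allFin)
open import Data.List.Relation.Unary.All as All using ([]; _∷_)
open import Data.List.Relation.Unary.All.Properties using (¬Any⇒All¬)
open import Data.List.Relation.Unary.AllPairs using ([]; _∷_)
open import Data.List.Relation.Unary.Any using (here; there)
open import Data.List.Relation.Unary.Linked using (Linked; [-]; _∷_)
open import Data.List.Relation.Unary.Unique.Propositional using (Unique)
open import Data.Nat.Base as ℕ
  using (ℕ; zero; suc; NonZero; _+_; _*_; _^_; _∸_; _!; _≤_; _<_; z≤n; s≤s)
open import Data.Nat.Induction using (<-wellFounded)
import Data.Nat.Properties as ℕ
open import Data.Nat.Tactic.RingSolver using (solve-∀)
open import Data.Product.Base using (∃-syntax; ∃₂; _×_; _,_; proj₁; proj₂)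
open import Data.Rational.Base as ℚ using (ℚ; 0ℚ; _/_)
import Data.Rational.Properties as ℚ
import Data.Rational.Unnormalised.Base as ℚᵘ
import Data.Rational.Unnormalised.Properties as ℚᵘ
open import Data.Sum.Base using (_⊎_; inj₁; inj₂; [_,_]′)
open import Data.Vec.Base as Vec using (Vec; []; _∷_; lookup; tabulate; updateAt)
open import Data.Vec.Functional using (removeAt)
open import Data.Vec.Properties
  using (lookup∘tabulate; tabulate∘lookup; tabulate-cong; []=⇒lookup; lookup⇒[]=;
         lookup∘updateAt; lookup∘updateAt′)
open import Function.Base using (_∘_)
open import Function.Bundles using (Bijection)
open import Induction.WellFounded using (Acc; acc)
open import Relation.Binary.Construct.Closure.ReflexiveTransitive as Star using (Star; ε; _◅_; _◅◅_)
open import Relation.Binary.PropositionalEquality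
  using (_≡_; _≢_; _≗_; refl; sym; trans; cong; cong₂; subst; subst₂; module ≡-Reasoning)
open import Relation.Nullary using (¬_; Dec; does; yes; no; contradiction; ¬?)
open import Relation.Nullary.Decidable using (dec-true; _×-dec_; _⊎-dec_)

open SemiringSum ℕ.+-*-semiring
  using (sum; sum-cong-≗; ∑-distrib-+; ∑-comm; *-distribˡ-sum; *-distribʳ-sum)
module 𝔽₂-Sum = CommutativeMonoidSum 𝔽₂.+-commutativeMonoid

-- Rational bounds for e and ln 3

toℚᵘ-/ : ∀ a b .{{_ : NonZero b}} → ℚ.toℚᵘ (+ a / b) ℚᵘ.≃ (+ a ℚᵘ./ b)
toℚᵘ-/ a (suc b) = ℚ.toℚᵘ-fromℚᵘ (ℚᵘ.mkℚᵘ (+ a) b)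

/-mono-≤ : ∀ a b c d .{{_ : NonZero b}} .{{_ : NonZero d}} → a * d ≤ c * b → + a / b ℚ.≤ + c / d
/-mono-≤ a b@(suc _) c d@(suc _) ad≤cb = ℚ.toℚᵘ-cancel-≤
  (ℚᵘ.≤-respˡ-≃ (ℚᵘ.≃-sym (toℚᵘ-/ a b)) (ℚᵘ.≤-respʳ-≃ (ℚᵘ.≃-sym (toℚᵘ-/ c d))
    (ℚᵘ.*≤* (subst₂ ℤ._≤_ (ℤ.pos-* a d) (ℤ.pos-* c b) (ℤ.+≤+ ad≤cb)))))

/-+ : ∀ a b c .{{_ : NonZero c}} → + a / c ℚ.+ + b / c ≡ + (a + b) / c
/-+ a b c@(suc _) = ℚ.toℚᵘ-injective
  (ℚᵘ.≃-trans (ℚ.toℚᵘ-homo-+ (+ a / c) (+ b / c))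
  (ℚᵘ.≃-trans (ℚᵘ.+-cong (toℚᵘ-/ a c) (toℚᵘ-/ b c))
  (ℚᵘ.≃-trans (ℚᵘ.*≡* common)
  (ℚᵘ.≃-sym (toℚᵘ-/ (a + b) c)))))
  where
  numerators : ∀ a b c → (a * c + b * c) * c ≡ (a + b) * (c * c)
  numerators = solve-∀
  common : (+ a ℤ.* + c ℤ.+ + b ℤ.* + c) ℤ.* + c ≡ + (a + b) ℤ.* + (c * c)
  common = trans (cong₂ (λ p q → (p ℤ.+ q) ℤ.* + c) (sym (ℤ.pos-* a c)) (sym (ℤ.pos-* b c)))
    (trans (sym (ℤ.pos-* (a * c + b * c) c))
    (trans (cong (+_) (numerators a b c)) (ℤ.pos-* (a + b) (c * c))))

/-* : ∀ a b c d .{{_ : NonZero b}} .{{_ : NonZero d}} .{{_ : NonZero (b * d)}} →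
      + a / b ℚ.* (+ c / d) ≡ + (a * c) / (b * d)
/-* a b@(suc _) c d@(suc _) = ℚ.toℚᵘ-injective
  (ℚᵘ.≃-trans (ℚ.toℚᵘ-homo-* (+ a / b) (+ c / d))
  (ℚᵘ.≃-trans (ℚᵘ.*-cong (toℚᵘ-/ a b) (toℚᵘ-/ c d))
  (ℚᵘ.≃-trans (ℚᵘ.*≡* (cong (ℤ._* (+ (b * d))) (sym (ℤ.pos-* a c))))
  (ℚᵘ.≃-sym (toℚᵘ-/ (a * c) (b * d))))))

0≤/ : ∀ a b .{{_ : NonZero b}} → 0ℚ ℚ.≤ + a / b
0≤/ a b = ℚ.nonNegative⁻¹ (+ a / b) {{ℚ.normalize-nonNeg a b}}

partialSum-≥0 : ∀ a → (∀ i → 0ℚ ℚ.≤ a i) → ∀ n → 0ℚ ℚ.≤ partialSum a n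
partialSum-≥0 a 0≤a zero    = ℚ.≤-refl
partialSum-≥0 a 0≤a (suc n) = ℚ.+-mono-≤ (partialSum-≥0 a 0≤a n) (0≤a n)

-- With q = p + 1, the geometric series of ratio 1 / q and first term p c / (d q) has sum c / d.
module _ (a : ℕ → ℚ) (c p d : ℕ) .{{d≢0 : NonZero d}} where

  private
    denominator : ℕ → ℕ
    denominator n = d * suc p ^ n

    denominator≢0 : ∀ n → NonZero (denominator n)
    denominator≢0 n = ℕ.m*n≢0 d (suc p ^ n) {{d≢0}} {{ℕ.m^n≢0 (suc p) n}}

    term : ℕ → ℕ → ℚ
    term x n = _/_ (+ x) (denominator n) {{denominator≢0 n}}

  partialSum≤geometric : (∀ n → a n ℚ.≤ term (p * c) (suc n)) → ∀ n → partialSum a n ℚ.≤ + c / d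
  partialSum≤geometric a≤ n = begin
    partialSum a n                 ≡⟨ ℚ.+-identityʳ (partialSum a n) ⟨
    partialSum a n ℚ.+ 0ℚ          ≤⟨ ℚ.+-monoʳ-≤ (partialSum a n)
                                        (0≤/ c (denominator n) {{denominator≢0 n}}) ⟩
    partialSum a n ℚ.+ term c n    ≤⟨ invariant n ⟩
    + c / d                        ∎
    where
    open ℚ.≤-Reasoning

    tail-step : ∀ n → a n ℚ.+ term c (suc n) ℚ.≤ term c n
    tail-step n = begin
      a n ℚ.+ term c (suc n)
        ≤⟨ ℚ.+-monoˡ-≤ (term c (suc n)) (a≤ n) ⟩
      term (p * c) (suc n) ℚ.+ term c (suc n)
        ≡⟨ /-+ (p * c) c (denominator (suc n)) {{denominator≢0 (suc n)}} ⟩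
      term (p * c + c) (suc n)
        ≤⟨ /-mono-≤ (p * c + c) (denominator (suc n)) c (denominator n)
             {{denominator≢0 (suc n)}} {{denominator≢0 n}} (ℕ.≤-reflexive (cancel p c d (suc p ^ n))) ⟩
      term c n
        ∎
      where
      cancel : ∀ p c d Q → (p * c + c) * (d * Q) ≡ c * (d * (suc p * Q))
      cancel = solve-∀

    -- `term c n` is the tail of the geometric series from index `n` on. Each new summand is paid
    -- for by the decrease of this tail, which at index 0 is the whole sum.
    invariant : ∀ n → partialSum a n ℚ.+ term c n ℚ.≤ + c / d
    invariant zero    = ℚ.≤-trans (ℚ.≤-reflexive (ℚ.+-identityˡ (term c 0)))
      (/-mono-≤ c (denominator 0) c d {{denominator≢0 0}}
        (ℕ.≤-reflexive (cong (c ℕ.*_) (sym (ℕ.*-identityʳ d)))))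
    invariant (suc n) = begin
      (partialSum a n ℚ.+ a n) ℚ.+ term c (suc n)    ≡⟨ ℚ.+-assoc (partialSum a n) (a n) (term c (suc n)) ⟩
      partialSum a n ℚ.+ (a n ℚ.+ term c (suc n))    ≤⟨ ℚ.+-monoʳ-≤ (partialSum a n) (tail-step n) ⟩
      partialSum a n ℚ.+ term c n                    ≤⟨ invariant n ⟩
      + c / d                                        ∎

2^n≤2*n! : ∀ n → 2 ^ n ≤ 2 * n !
2^n≤2*n! zero          = s≤s z≤n
2^n≤2*n! (suc zero)    = ℕ.≤-refl
2^n≤2*n! (suc (suc n)) = ℕ.*-monoʳ-≤ 2
  (ℕ.≤-trans (2^n≤2*n! (suc n)) (ℕ.*-monoˡ-≤ (suc n !) (s≤s (s≤s (z≤n {n})))))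

-- Since 2^n ≤ 2 n!, the summand 1 / n! is at most 4 / 2^(n+1), which is the geometric series of
-- ratio 1/2 and sum 4.
e≤4 : ∀ n → seq e n ℚ.≤ + 4 / 1
e≤4 = partialSum≤geometric 1/_! 4 1 1 λ n →
  /-mono-≤ 1 (n !) 4 (1 * 2 ^ suc n) {{n ℕ.!≢0}} {{ℕ.m*n≢0 1 (2 ^ suc n) {{_}} {{ℕ.m^n≢0 2 (suc n)}}}} (begin
    1 * (1 * 2 ^ suc n)    ≡⟨ trans (ℕ.*-identityˡ _) (ℕ.*-identityˡ _) ⟩
    2 * 2 ^ n              ≤⟨ ℕ.*-monoʳ-≤ 2 (2^n≤2*n! n) ⟩
    2 * (2 * n !)          ≡⟨ ℕ.*-assoc 2 2 (n !) ⟨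
    4 * n !                ∎)
  where open ℕ.≤-Reasoning

-- Dropping the factor 2n + 1 from the denominators leaves the terms 1 / 4^n, whose sum is 4/3.
ln3≤4/3 : ∀ n → seq ln3 n ℚ.≤ + 4 / 3
ln3≤4/3 = partialSum≤geometric ln3-term 4 3 3 λ n →
  /-mono-≤ 2 (ln3-denominator n) 12 (3 * 4 ^ suc n) {{ln3-denominator≢0 n}}
    {{ℕ.m*n≢0 3 (4 ^ suc n) {{_}} {{ℕ.m^n≢0 4 (suc n)}}}} (begin
    2 * (3 * (4 * 4 ^ n))          ≡⟨ cong (λ x → 2 * (3 * (4 * x))) (ℕ.^-*-assoc 2 2 n) ⟩
    2 * (3 * (4 * 2 ^ (2 * n)))    ≡⟨ regroup (2 ^ (2 * n)) ⟩
    12 * (2 ^ suc (2 * n))         ≤⟨ ℕ.*-monoʳ-≤ 12 (ℕ.m≤m*n (2 ^ suc (2 * n)) (suc (2 * n))) ⟩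
    12 * ln3-denominator n         ∎)
  where
  open ℕ.≤-Reasoning
  regroup : ∀ x → 2 * (3 * (4 * x)) ≡ 12 * (2 * x)
  regroup = solve-∀

0≤ln3 : ∀ n → 0ℚ ℚ.≤ seq ln3 n
0≤ln3 = partialSum-≥0 ln3-term λ i → 0≤/ 2 (ln3-denominator i) {{ln3-denominator≢0 i}}

e*ln3/12≤4/9 : ∀ i → seq (e *ᴿ ln3 *ᴿ fromℚ (+ 1 / 12)) i ℚ.≤ + 4 / 9
-- The closed product 4 · 4/3 · 1/12 evaluates to 4/9.
e*ln3/12≤4/9 i = ℚ.*-monoʳ-≤-nonNeg (+ 1 / 12) (begin
  seq e i ℚ.* seq ln3 i          ≤⟨ ℚ.*-monoʳ-≤-nonNeg (seq ln3 i) {{ℚ.nonNegative (0≤ln3 i)}} (e≤4 i) ⟩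
  + 4 / 1 ℚ.* seq ln3 i          ≤⟨ ℚ.*-monoˡ-≤-nonNeg (+ 4 / 1) (ln3≤4/3 i) ⟩
  + 4 / 1 ℚ.* (+ 4 / 3)          ∎)
  where open ℚ.≤-Reasoning

-- Edge-isoperimetry in grids

[_]ᵇ : Bool → ℕ
[ true  ]ᵇ = 1
[ false ]ᵇ = 0

sum-mono-≤ : ∀ {n} {f g : Fin n → ℕ} → (∀ i → f i ≤ g i) → sum f ≤ sum g
sum-mono-≤ {zero}  f≤g = z≤n
sum-mono-≤ {suc n} f≤g = ℕ.+-mono-≤ (f≤g zero) (sum-mono-≤ (f≤g ∘ suc))

sum-const : ∀ n c → sum {n} (λ _ → c) ≡ n * c
sum-const zero    c = refl
sum-const (suc n) c = cong (λ s → c + s) (sum-const n c)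

term≤sum : ∀ {n} (f : Fin n → ℕ) i → f i ≤ sum f
term≤sum f zero    = ℕ.m≤m+n _ _
term≤sum f (suc i) = ℕ.m≤n⇒m≤o+n (f zero) (term≤sum (f ∘ suc) i)

sum-↑ : ∀ m {n} (f : Fin (m + n) → ℕ) → sum f ≡ sum (λ i → f (i ↑ˡ n)) + sum (λ i → f (m ↑ʳ i))
sum-↑ zero    f = refl
sum-↑ (suc m) f = trans (cong (λ s → f zero + s) (sum-↑ m (f ∘ suc))) (sym (ℕ.+-assoc (f zero) _ _))

sum-combine : ∀ m {n} (f : Fin (m * n) → ℕ) → sum f ≡ sum {m} (λ i → sum {n} (λ j → f (combine i j)))
sum-combine zero        f = refl
sum-combine (suc m) {n} f = trans (sum-↑ n f)
  (cong (λ s → sum (λ j → f (j ↑ˡ (m * n))) + s) (sum-combine m (f ∘ (n ↑ʳ_))))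

∣p∣≡sum : ∀ {n} (p : Subset n) → ∣ p ∣ ≡ sum ([_]ᵇ ∘ lookup p)
∣p∣≡sum []          = refl
∣p∣≡sum (true ∷ p)  = cong suc (∣p∣≡sum p)
∣p∣≡sum (false ∷ p) = ∣p∣≡sum p

-- Sums run over vectors instead of codes in `Fin (m ^ k)`, so that an induction on `k` can split
-- off the first coordinate.
∑ᵛ : ∀ {m} k → (Vec (Fin m) k → ℕ) → ℕ
∑ᵛ zero    f = f []
∑ᵛ (suc k) f = sum λ a → ∑ᵛ k (f ∘ (a ∷_))

module _ {m : ℕ} where

  encode : ∀ {k} → Vec (Fin m) k → Fin (m ^ k)
  encode = funToFin ∘ lookup

  decode : ∀ {k} → Fin (m ^ k) → Vec (Fin m) k
  decode = tabulate ∘ finToFun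

  decode-encode : ∀ {k} (v : Vec (Fin m) k) → decode (encode v) ≡ v
  decode-encode v = trans (tabulate-cong (finToFun-funToFin (lookup v))) (tabulate∘lookup v)

  ∑ᵛ-cong : ∀ k {f g : Vec (Fin m) k → ℕ} → f ≗ g → ∑ᵛ k f ≡ ∑ᵛ k g
  ∑ᵛ-cong zero    f≗g = f≗g []
  ∑ᵛ-cong (suc k) f≗g = sum-cong-≗ λ a → ∑ᵛ-cong k (f≗g ∘ (a ∷_))

  ∑ᵛ-mono-≤ : ∀ k {f g : Vec (Fin m) k → ℕ} → (∀ v → f v ≤ g v) → ∑ᵛ k f ≤ ∑ᵛ k g
  ∑ᵛ-mono-≤ zero    f≤g = f≤g []
  ∑ᵛ-mono-≤ (suc k) f≤g = sum-mono-≤ λ a → ∑ᵛ-mono-≤ k (f≤g ∘ (a ∷_))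

  ∑ᵛ-distrib-+ : ∀ k (f g : Vec (Fin m) k → ℕ) → ∑ᵛ k (λ v → f v + g v) ≡ ∑ᵛ k f + ∑ᵛ k g
  ∑ᵛ-distrib-+ zero    f g = refl
  ∑ᵛ-distrib-+ (suc k) f g = trans
    (sum-cong-≗ λ a → ∑ᵛ-distrib-+ k (f ∘ (a ∷_)) (g ∘ (a ∷_)))
    (∑-distrib-+ (λ a → ∑ᵛ k (f ∘ (a ∷_))) (λ a → ∑ᵛ k (g ∘ (a ∷_))))

  *-distribˡ-∑ᵛ : ∀ k c (f : Vec (Fin m) k → ℕ) → c * ∑ᵛ k f ≡ ∑ᵛ k (λ v → c * f v)
  *-distribˡ-∑ᵛ zero    c f = refl
  *-distribˡ-∑ᵛ (suc k) c f = trans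
    (*-distribˡ-sum c (λ a → ∑ᵛ k (f ∘ (a ∷_))))
    (sum-cong-≗ λ a → *-distribˡ-∑ᵛ k c (f ∘ (a ∷_)))

  ∑ᵛ-sum-comm : ∀ k {n} (f : Fin n → Vec (Fin m) k → ℕ) →
                sum (λ i → ∑ᵛ k (f i)) ≡ ∑ᵛ k (λ v → sum (λ i → f i v))
  ∑ᵛ-sum-comm zero    f = refl
  ∑ᵛ-sum-comm (suc k) f = trans
    (∑-comm (λ i a → ∑ᵛ k (f i ∘ (a ∷_))))
    (sum-cong-≗ λ a → ∑ᵛ-sum-comm k (λ i → f i ∘ (a ∷_)))

  ∑ᵛ-one : ∀ k → ∑ᵛ {m} k (λ _ → 1) ≡ m ^ k
  ∑ᵛ-one zero    = refl
  ∑ᵛ-one (suc k) = trans (sum-cong-≗ {m} λ _ → ∑ᵛ-one k) (sum-const m (m ^ k))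

  -- `encode (a ∷ x)` unfolds to `combine a (encode x)`, so both sums split along the same first
  -- coordinate.
  sum-encode : ∀ k (f : Fin (m ^ k) → ℕ) → sum f ≡ ∑ᵛ k (f ∘ encode)
  sum-encode zero    f = ℕ.+-identityʳ (f zero)
  sum-encode (suc k) f = trans (sum-combine m f) (sum-cong-≗ {m} λ a → sum-encode k (f ∘ combine a))

  count : ∀ k → (Vec (Fin m) k → Bool) → ℕ
  count k f = ∑ᵛ k ([_]ᵇ ∘ f)

  count+count-not : ∀ k (f : Vec (Fin m) k → Bool) → count k f + count k (not ∘ f) ≡ m ^ k
  count+count-not k f = begin
    count k f + count k (not ∘ f)             ≡⟨ ∑ᵛ-distrib-+ k _ _ ⟨
    ∑ᵛ k (λ v → [ f v ]ᵇ + [ not (f v) ]ᵇ)    ≡⟨ ∑ᵛ-cong k (λ v → [b]+[not-b] (f v)) ⟩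
    ∑ᵛ {m} k (λ _ → 1)                        ≡⟨ ∑ᵛ-one k ⟩
    m ^ k                                     ∎
    where
    open ≡-Reasoning
    [b]+[not-b] : ∀ b → [ b ]ᵇ + [ not b ]ᵇ ≡ 1
    [b]+[not-b] true  = refl
    [b]+[not-b] false = refl

  -- Where `σ` fixes the coordinate, `updateAt v i σ` is `v` and there is no exit. Moves that stay
  -- put at the border of the grid are therefore harmless.
  exit : ∀ {k} → (Fin m → Fin m) → Fin k → (Vec (Fin m) k → Bool) → Vec (Fin m) k → Bool
  exit σ i f v = f v ∧ not (f (updateAt v i σ))

-- The largest element is mapped to itself, as pred maps zero to itself.
up : ∀ {m} → Fin m → Fin m
up {suc zero}    zero    = zero
up {suc (suc m)} zero    = suc zero
up               (suc i) = suc (up i)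

up-inject₁ : ∀ {m} (i : Fin m) → up (inject₁ i) ≡ suc i
up-inject₁ zero    = refl
up-inject₁ (suc i) = cong suc (up-inject₁ i)

-- The two sides differ by the square of the difference `d` of `a` and `b`.
4ab≤[a+b]² : ∀ a b → 4 * (a * b) ≤ (a + b) * (a + b)
4ab≤[a+b]² a b with ℕ.≤-total a b
... | inj₁ a≤b with d , refl ← ℕ.m≤n⇒∃[o]m+o≡n a≤b =
  ℕ.≤-trans (ℕ.m≤m+n _ (d * d)) (ℕ.≤-reflexive (square a d))
  where
  square : ∀ a d → 4 * (a * (a + d)) + d * d ≡ (a + (a + d)) * (a + (a + d))
  square = solve-∀
... | inj₂ b≤a with d , refl ← ℕ.m≤n⇒∃[o]m+o≡n b≤a =
  ℕ.≤-trans (ℕ.m≤m+n _ (d * d)) (ℕ.≤-reflexive (square b d))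
  where
  square : ∀ b d → 4 * ((b + d) * b) + d * d ≡ ((b + d) + b) * ((b + d) + b)
  square = solve-∀

-- Each edge of the path with exactly one end in `g` is counted once, at that end and in the sense
-- that leads out.
lineExits : ∀ {m} → (Fin m → Bool) → ℕ
lineExits g = sum (λ a → [ g a ∧ not (g (up a)) ]ᵇ) + sum (λ a → [ g a ∧ not (g (pred a)) ]ᵇ)

-- An edge of the path on which `g` changes is an exit upwards or downwards. Without exits the value
-- at `zero` thus propagates along the whole path.
lineExits≡0⇒constant : ∀ {m} (g : Fin (suc m) → Bool) → lineExits g ≡ 0 → ∀ i → g i ≡ g zero
lineExits≡0⇒constant g none = <-weakInduction (λ i → g i ≡ g zero) refl
  λ i gi≡g0 → trans (sym (neighbours i)) gi≡g0
  where
  ups downs : Fin _ → ℕ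
  ups a   = [ g a ∧ not (g (up a)) ]ᵇ
  downs a = [ g a ∧ not (g (pred a)) ]ᵇ
  no-up : ∀ a → ups a ≡ 0
  no-up a = ℕ.n≤0⇒n≡0 (subst (ups a ≤_) (ℕ.m+n≡0⇒m≡0 (sum ups) none) (term≤sum ups a))
  no-down : ∀ a → downs a ≡ 0
  no-down a = ℕ.n≤0⇒n≡0 (subst (downs a ≤_) (ℕ.m+n≡0⇒n≡0 (sum ups) none) (term≤sum downs a))
  equal : ∀ b c → [ b ∧ not c ]ᵇ ≡ 0 → [ c ∧ not b ]ᵇ ≡ 0 → b ≡ c
  equal true  true  _  _  = refl
  equal true  false () _
  equal false true  _  ()
  equal false false _  _  = refl
  neighbours : ∀ i → g (inject₁ i) ≡ g (suc i)
  neighbours i = equal _ _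
    (subst (λ j → [ g (inject₁ i) ∧ not (g j) ]ᵇ ≡ 0) (up-inject₁ i) (no-up (inject₁ i)))
    (no-down (suc i))

-- One exit already suffices, because the left side never exceeds m². Without exits `g` is constant
-- and one of the two factors vanishes.
line-isoperimetry : ∀ m (g : Fin m → Bool) →
  4 * (sum ([_]ᵇ ∘ g) * sum ([_]ᵇ ∘ not ∘ g)) ≤ m * m * lineExits g
line-isoperimetry zero    g = z≤n
line-isoperimetry (suc m) g with lineExits g in eq
... | suc l = begin
  4 * (a * b)                      ≤⟨ 4ab≤[a+b]² a b ⟩
  (a + b) * (a + b)                ≡⟨ cong (λ s → s * s) a+b≡1+m ⟩
  suc m * suc m                    ≤⟨ ℕ.m≤m*n (suc m * suc m) (suc l) ⟩
  suc m * suc m * suc l            ∎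
  where
  open ℕ.≤-Reasoning
  a = sum ([_]ᵇ ∘ g)
  b = sum ([_]ᵇ ∘ not ∘ g)
  a+b≡1+m : a + b ≡ suc m
  -- Over vectors of length one, `count` unfolds to the sum over `Fin (suc m)`.
  a+b≡1+m = trans (count+count-not 1 (g ∘ Vec.head)) (ℕ.^-identityʳ (suc m))
... | zero = ℕ.≤-reflexive (trans (cong (4 *_) (product≡0 (g zero) (lineExits≡0⇒constant g eq)))
                                 (sym (ℕ.*-zeroʳ (suc m * suc m))))
  where
  product≡0 : ∀ b → (∀ i → g i ≡ b) → sum ([_]ᵇ ∘ g) * sum ([_]ᵇ ∘ not ∘ g) ≡ 0
  product≡0 true  g≗b = trans (cong (sum ([_]ᵇ ∘ g) *_)
    (trans (sum-cong-≗ λ i → cong ([_]ᵇ ∘ not) (g≗b i)) (trans (sum-const (suc m) 0) (ℕ.*-zeroʳ (suc m)))))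
    (ℕ.*-zeroʳ (sum ([_]ᵇ ∘ g)))
  product≡0 false g≗b = cong (_* sum ([_]ᵇ ∘ not ∘ g))
    (trans (sum-cong-≗ λ i → cong [_]ᵇ (g≗b i)) (trans (sum-const (suc m) 0) (ℕ.*-zeroʳ (suc m))))

exits : ∀ {m k} → (Vec (Fin m) k → Bool) → Fin k → ℕ
exits {k = k} f i = count k (exit up i f) + count k (exit pred i f)

-- Passing from a pair (s ∷ x , t ∷ y) with f (s ∷ x) and not f (t ∷ y) through the
-- hybrid t ∷ x, either the first coordinate or the remaining ones leave f.
isoperimetry : ∀ m k (f : Vec (Fin m) k → Bool) →
  4 * (count k f * count k (not ∘ f)) ≤ m ^ suc k * sum (exits f)
-- The single vertex lies inside or outside `f`, so one of the two counts is 0.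
isoperimetry m zero f = ℕ.≤-trans (ℕ.≤-reflexive (cong (4 *_) ([b][not-b] (f [])))) z≤n
  where
  [b][not-b] : ∀ b → [ b ]ᵇ * [ not b ]ᵇ ≡ 0
  [b][not-b] true  = refl
  [b][not-b] false = refl
isoperimetry m (suc k) f = begin
  4 * (count (suc k) f * count (suc k) (not ∘ f))
    ≤⟨ ℕ.*-monoʳ-≤ 4 pairs ⟩
  4 * (M * ∑ᵛ k (λ x → p x * q x) + m * sum (λ t → a t * b t))
    ≡⟨ distrib 4 M (∑ᵛ k (λ x → p x * q x)) m (sum (λ t → a t * b t)) ⟩
  M * (4 * ∑ᵛ k (λ x → p x * q x)) + m * (4 * sum (λ t → a t * b t))
    ≡⟨ cong₂ (λ u v → M * u + m * v) (*-distribˡ-∑ᵛ k 4 _) (*-distribˡ-sum 4 (λ t → a t * b t)) ⟩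
  M * ∑ᵛ k (λ x → 4 * (p x * q x)) + m * sum (λ t → 4 * (a t * b t))
    -- Lines in the first coordinate fall under `line-isoperimetry`, slices with a fixed first
    -- coordinate under the induction hypothesis.
    ≤⟨ ℕ.+-mono-≤ (ℕ.*-monoʳ-≤ M (∑ᵛ-mono-≤ k λ x → line-isoperimetry m (λ s → f (s ∷ x))))
                  (ℕ.*-monoʳ-≤ m (sum-mono-≤ λ t → isoperimetry m k (f ∘ (t ∷_)))) ⟩
  M * ∑ᵛ k (λ x → m * m * l x) + m * sum (λ t → m * M * sum (exits (f ∘ (t ∷_))))
    ≡⟨ cong₂ (λ u v → M * u + m * v) (*-distribˡ-∑ᵛ k (m * m) l)
                                     (*-distribˡ-sum (m * M) (λ t → sum (exits (f ∘ (t ∷_))))) ⟨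
  M * (m * m * ∑ᵛ k l) + m * (m * M * sum (λ t → sum (exits (f ∘ (t ∷_)))))
    ≡⟨ factor m M (∑ᵛ k l) _ ⟩
  m * (m * M) * (∑ᵛ k l + sum (λ t → sum (exits (f ∘ (t ∷_)))))
    ≡⟨ cong (m * (m * M) *_) (cong₂ _+_ first rest) ⟩
  m * (m * M) * sum (exits f) ∎
  where
  open ℕ.≤-Reasoning
  M = m ^ k
  a b : Fin m → ℕ
  a t = count k (f ∘ (t ∷_))
  b t = count k (not ∘ f ∘ (t ∷_))
  p q l : Vec (Fin m) k → ℕ
  p x = sum (λ s → [ f (s ∷ x) ]ᵇ)
  q x = sum (λ t → [ not (f (t ∷ x)) ]ᵇ)
  l x = lineExits (λ s → f (s ∷ x))
  D : Fin m → Fin m → Vec (Fin m) k → ℕ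
  D s t x = [ f (s ∷ x) ]ᵇ * [ not (f (t ∷ x)) ]ᵇ

  distrib : ∀ c M u m v → c * (M * u + m * v) ≡ M * (c * u) + m * (c * v)
  distrib = solve-∀
  factor : ∀ m M u v → M * (m * m * u) + m * (m * M * v) ≡ m * (m * M) * (u + v)
  factor = solve-∀

  first : ∑ᵛ k l ≡ exits f zero
  first = trans (∑ᵛ-distrib-+ k (λ x → sum (λ a → ups a x)) (λ x → sum (λ a → downs a x)))
                (sym (cong₂ _+_ (∑ᵛ-sum-comm k ups) (∑ᵛ-sum-comm k downs)))
    where
    ups downs : Fin m → Vec (Fin m) k → ℕ
    ups a x   = [ exit up zero f (a ∷ x) ]ᵇ
    downs a x = [ exit pred zero f (a ∷ x) ]ᵇ

  -- A move in a later coordinate stays within its slice, so the exits of the slices add up to the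
  -- exits of `f` in that direction.
  rest : sum (λ t → sum (exits (f ∘ (t ∷_)))) ≡ sum (exits f ∘ suc)
  rest = trans (∑-comm (λ t → exits (f ∘ (t ∷_)))) (sum-cong-≗ λ i →
    ∑-distrib-+ (λ t → count k (exit up i (f ∘ (t ∷_)))) (λ t → count k (exit pred i (f ∘ (t ∷_)))))

  b≤M : ∀ t → b t ≤ M
  b≤M t = ℕ.≤-trans (ℕ.m≤n+m (b t) (a t)) (ℕ.≤-reflexive (count+count-not k (f ∘ (t ∷_))))

  -- Used with `u` for `f (s ∷ x)` and `v` for the hybrid `f (t ∷ x)`: either the first coordinate
  -- leaves `f`, or the hybrid is still in `f`.
  hybrid : ∀ u v → [ u ]ᵇ ≤ [ u ]ᵇ * [ not v ]ᵇ + [ v ]ᵇ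
  hybrid false v     = z≤n
  hybrid true  true  = ℕ.≤-refl
  hybrid true  false = ℕ.≤-refl

  -- If the hybrid `t ∷ x` is outside `f`, then `y` is only known to take at most `M` values. If it
  -- is inside, a pair within the slice `t` remains; this term is independent of `s`, whence the
  -- factor `m` in `pairs`.
  pair : ∀ s t → a s * b t ≤ M * ∑ᵛ k (D s t) + a t * b t
  pair s t = begin
    a s * b t
      ≤⟨ ℕ.*-monoˡ-≤ (b t) (∑ᵛ-mono-≤ k λ x → hybrid (f (s ∷ x)) (f (t ∷ x))) ⟩
    ∑ᵛ k (λ x → D s t x + [ f (t ∷ x) ]ᵇ) * b t
      ≡⟨ cong (_* b t) (∑ᵛ-distrib-+ k _ _) ⟩
    (∑ᵛ k (D s t) + a t) * b t
      ≡⟨ ℕ.*-distribʳ-+ (b t) (∑ᵛ k (D s t)) (a t) ⟩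
    ∑ᵛ k (D s t) * b t + a t * b t
      ≤⟨ ℕ.+-monoˡ-≤ (a t * b t) (ℕ.*-monoʳ-≤ (∑ᵛ k (D s t)) (b≤M t)) ⟩
    ∑ᵛ k (D s t) * M + a t * b t
      ≡⟨ cong (_+ a t * b t) (ℕ.*-comm (∑ᵛ k (D s t)) M) ⟩
    M * ∑ᵛ k (D s t) + a t * b t           ∎

  sum*sum : ∀ {n} (u v : Fin n → ℕ) → sum u * sum v ≡ sum (λ s → sum (λ t → u s * v t))
  sum*sum u v = trans (*-distribʳ-sum (sum v) u) (sum-cong-≗ λ s → *-distribˡ-sum (u s) v)

  collect : sum (λ s → sum (λ t → ∑ᵛ k (D s t))) ≡ ∑ᵛ k (λ x → p x * q x)
  collect = begin-equality
    sum (λ s → sum (λ t → ∑ᵛ k (D s t)))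
      ≡⟨ sum-cong-≗ (λ s → ∑ᵛ-sum-comm k (D s)) ⟩
    sum (λ s → ∑ᵛ k (λ x → sum (λ t → D s t x)))
      ≡⟨ ∑ᵛ-sum-comm k (λ s x → sum (λ t → D s t x)) ⟩
    ∑ᵛ k (λ x → sum (λ s → sum (λ t → D s t x)))
      ≡⟨ ∑ᵛ-cong k (λ x → sum*sum (λ s → [ f (s ∷ x) ]ᵇ) (λ t → [ not (f (t ∷ x)) ]ᵇ)) ⟨
    ∑ᵛ k (λ x → p x * q x) ∎

  pairs : sum a * sum b ≤ M * ∑ᵛ k (λ x → p x * q x) + m * sum (λ t → a t * b t)
  pairs = begin
    sum a * sum b
      ≡⟨ sum*sum a b ⟩
    sum (λ s → sum (λ t → a s * b t))
      ≤⟨ sum-mono-≤ (λ s → sum-mono-≤ (pair s)) ⟩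
    sum (λ s → sum (λ t → M * ∑ᵛ k (D s t) + a t * b t))
      ≡⟨ sum-cong-≗ (λ s → trans (∑-distrib-+ (λ t → M * ∑ᵛ k (D s t)) (λ t → a t * b t))
           (cong (_+ sum (λ t → a t * b t)) (sym (*-distribˡ-sum M (λ t → ∑ᵛ k (D s t)))))) ⟩
    sum (λ s → M * sum (λ t → ∑ᵛ k (D s t)) + sum (λ t → a t * b t))
      ≡⟨ ∑-distrib-+ (λ s → M * sum (λ t → ∑ᵛ k (D s t))) (λ _ → sum (λ t → a t * b t)) ⟩
    sum (λ s → M * sum (λ t → ∑ᵛ k (D s t))) + sum {m} (λ _ → sum (λ t → a t * b t))
      ≡⟨ cong₂ _+_ (trans (sym (*-distribˡ-sum M (λ s → sum (λ t → ∑ᵛ k (D s t))))) (cong (M *_) collect))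
                   (sum-const m _) ⟩
    M * ∑ᵛ k (λ x → p x * q x) + m * sum (λ t → a t * b t) ∎

-- Balanced edges of rank-decompositions

module _ {n} {P : Fin n → Set} (P? : ∀ i → Dec (P i)) where

  ∈-tabulate⁺ : ∀ {i} → P i → i ∈ tabulate (does ∘ P?)
  ∈-tabulate⁺ {i} p = lookup⇒[]= i _ (trans (lookup∘tabulate (does ∘ P?) i) (dec-true (P? i) p))

  ∈-tabulate⁻ : ∀ {i} → i ∈ tabulate (does ∘ P?) → P i
  ∈-tabulate⁻ {i} i∈ with P? i | trans (sym (lookup∘tabulate (does ∘ P?) i)) ([]=⇒lookup i∈)
  ... | yes p | _ = p
  ... | no _  | ()

∣p∣≡suc⇒nonempty : ∀ {n k} (p : Subset n) → ∣ p ∣ ≡ suc k → Nonempty p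
∣p∣≡suc⇒nonempty {n} p eq with nonempty? p
... | yes ne = ne
... | no ¬ne = contradiction (trans (sym eq) (trans (cong ∣_∣ (Empty-unique ¬ne)) (∣⊥∣≡0 n))) λ ()

∣p∪q∣≤∣p∣+∣q∣ : ∀ {n} (p q : Subset n) → ∣ p ∪ q ∣ ≤ ∣ p ∣ + ∣ q ∣
∣p∪q∣≤∣p∣+∣q∣ []            []            = z≤n
∣p∪q∣≤∣p∣+∣q∣ (outside ∷ p) (outside ∷ q) = ∣p∪q∣≤∣p∣+∣q∣ p q
∣p∪q∣≤∣p∣+∣q∣ (outside ∷ p) (inside ∷ q)  =
  ℕ.≤-trans (s≤s (∣p∪q∣≤∣p∣+∣q∣ p q)) (ℕ.≤-reflexive (sym (ℕ.+-suc ∣ p ∣ ∣ q ∣)))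
∣p∪q∣≤∣p∣+∣q∣ (inside ∷ p)  (outside ∷ q) = s≤s (∣p∪q∣≤∣p∣+∣q∣ p q)
∣p∪q∣≤∣p∣+∣q∣ (inside ∷ p)  (inside ∷ q)  =
  s≤s (ℕ.≤-trans (∣p∪q∣≤∣p∣+∣q∣ p q) (ℕ.+-monoʳ-≤ ∣ p ∣ (ℕ.n≤1+n ∣ q ∣)))

covered⇒∣p∣≤ : ∀ {n} (p q r : Subset n) → (∀ {i} → i ∈ p → i ∈ q ⊎ i ∈ r) → ∣ p ∣ ≤ ∣ q ∣ + ∣ r ∣
covered⇒∣p∣≤ p q r cover =
  ℕ.≤-trans (p⊆q⇒∣p∣≤∣q∣ {p = p} {q ∪ r} (x∈p∪q⁺ ∘ cover)) (∣p∪q∣≤∣p∣+∣q∣ q r)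

∣p-x∣≡k : ∀ {n k x} (p : Subset n) → x ∈ p → ∣ p ∣ ≡ suc k → ∣ p - x ∣ ≡ k
∣p-x∣≡k {k = k} {x} p x∈p eq = ℕ.≤-antisym
  (ℕ.≤-pred (subst (∣ p - x ∣ <_) eq (x∈p⇒∣p-x∣<∣p∣ x∈p)))
  (ℕ.≤-pred (ℕ.≤-trans (ℕ.≤-reflexive (sym eq))
    (subst (λ c → ∣ p ∣ ≤ c + ∣ p - x ∣) (∣⁅x⁆∣≡1 x) (covered⇒∣p∣≤ p ⁅ x ⁆ (p - x) split))))
  where
  split : ∀ {i} → i ∈ p → i ∈ ⁅ x ⁆ ⊎ i ∈ p - x
  split {i} i∈p with i ≟ᶠ x
  ... | yes refl = inj₁ (x∈⁅x⁆ x)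
  ... | no i≢x   = inj₂ (x∈p∧x≢y⇒x∈p-y i∈p i≢x)

∣p∣≡0⇒∉ : ∀ {n x} (p : Subset n) → ∣ p ∣ ≡ 0 → x ∉ p
∣p∣≡0⇒∉ p eq x∈p = ℕ.n≮0 (subst (∣ p - _ ∣ <_) eq (x∈p⇒∣p-x∣<∣p∣ x∈p))

∣p∣≡1⇒unique : ∀ {n x y} (p : Subset n) → ∣ p ∣ ≡ 1 → x ∈ p → y ∈ p → y ≡ x
∣p∣≡1⇒unique {x = x} {y} p eq x∈p y∈p with y ≟ᶠ x
... | yes y≡x = y≡x
... | no y≢x  = contradiction (x∈p∧x≢y⇒x∈p-y y∈p y≢x) (∣p∣≡0⇒∉ (p - x) (∣p-x∣≡k p x∈p eq))

∣p∣≡3⇒others : ∀ {n x} (p : Subset n) → ∣ p ∣ ≡ 3 → x ∈ p →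
  ∃₂ λ y z → (y ∈ p × y ≢ x) × (z ∈ p × z ≢ x) × (∀ {w} → w ∈ p → w ≢ x → w ≡ y ⊎ w ≡ z)
∣p∣≡3⇒others {x = x} p eq x∈p with ∣p∣≡suc⇒nonempty (p - x) (∣p-x∣≡k p x∈p eq)
... | y , y∈ with ∣p∣≡suc⇒nonempty (p - x - y) (∣p-x∣≡k (p - x) y∈ (∣p-x∣≡k p x∈p eq))
... | z , z∈ = y , z , ∈p-x y∈ , ∈p-x (p─q⊆p (p - x) ⁅ y ⁆ z∈) , others
  where
  ∈p-x : ∀ {w} → w ∈ p - x → w ∈ p × w ≢ x
  ∈p-x w∈ = p─q⊆p p ⁅ x ⁆ w∈ , λ { refl → x∉p-x w∈ }
    where
    x∉p-x : x ∉ p - x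
    -- Removing `x` a second time changes nothing, yet it would make a set containing `x` strictly
    -- smaller.
    x∉p-x x∈p-x = ℕ.<⇒≢ (x∈p⇒∣p-x∣<∣p∣ x∈p-x) (cong ∣_∣ (p─q─q≡p─q p ⁅ x ⁆))
  others : ∀ {w} → w ∈ p → w ≢ x → w ≡ y ⊎ w ≡ z
  others {w} w∈p w≢x with w ≟ᶠ y
  ... | yes w≡y = inj₁ w≡y
  ... | no w≢y  = inj₂ (∣p∣≡1⇒unique (p - x - y) (∣p-x∣≡k (p - x) y∈ (∣p-x∣≡k p x∈p eq)) z∈
    (x∈p∧x≢y⇒x∈p-y (x∈p∧x≢y⇒x∈p-y w∈p w≢x) w≢y))

-- In Walk R v us, the list us holds the vertices of a walk along R that ends in v.
data Walk {A : Set} (R : A → A → Set) (v : A) : List A → Set where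
  stop : Walk R v [ v ]
  step : ∀ {u w us} → R u w → Walk R v (w ∷ us) → Walk R v (u ∷ w ∷ us)

module _ {n} {R : Fin n → Fin n → Set} where

  private
    open DecMembership (_≟ᶠ_ {n}) using () renaming (_∈?_ to _∈ˡ?_)

    shortcut : ∀ {u v xs} → u ∈ˡ xs → Unique xs → Walk R v xs → ∃[ us ] (Unique (u ∷ us) × Walk R v (u ∷ us))
    shortcut (here refl) uniq       walk          = _ , uniq , walk
    shortcut (there u∈)  (_ ∷ uniq) (step _ walk) = shortcut u∈ uniq walk

  -- Loop erasure: if the new start `u` already occurs on the simple walk, the walk is cut down to
  -- its part from `u` on.
  simpleWalk : ∀ {u v} → Star R u v → ∃[ us ] (Unique (u ∷ us) × Walk R v (u ∷ us))
  simpleWalk ε = [] , ([] ∷ []) , stop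
  simpleWalk {u} (r ◅ rs) with simpleWalk rs
  ... | us , uniq , walk with u ∈ˡ? (_ ∷ us)
  ...   | yes u∈ = shortcut u∈ uniq walk
  ...   | no u∉  = _ , ¬Any⇒All¬ _ u∉ ∷ uniq , step r walk

-- Closes a walk by a last step from `v` to `w`, in the form in which `IsCycle` expects it.
Walk⇒Linked : ∀ {A : Set} {R S : A → A → Set} {v w us} → (∀ {x y} → R x y → S x y) → S v w →
              Walk R v us → Linked S (us ++ [ w ])
Walk⇒Linked R⊆S s stop          = s ∷ [-]
Walk⇒Linked R⊆S s (step r walk) = R⊆S r ∷ Walk⇒Linked R⊆S s walk

-- Deleting an edge of a tree

module TreeProperties {t} (T : Graph t) (isTree : IsTree T) where
  open IsTree isTree

  _∼_ : Fin t → Fin t → Set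
  _∼_ = Adj T

  reachable-sym : ∀ {x y u v} → Reachable (deleteEdge T x y) u v → Reachable (deleteEdge T y x) u v
  reachable-sym = Star.map λ { (u∼v , ≢xy) → u∼v , λ { (inj₁ p) → ≢xy (inj₂ p) ; (inj₂ p) → ≢xy (inj₁ p) } }

  ∼⇒≢ : ∀ {x y} → x ∼ y → x ≢ y
  ∼⇒≢ x∼y refl = irrefl T x∼y

  -- A simple walk from `y` to `x` without the edge `xy` would be closed to a cycle by that edge.
  -- Walks too short for a cycle would force `y` to be `x` or would use the deleted edge itself.
  separated : ∀ {x y} → x ∼ y → ¬ Reachable (deleteEdge T x y) y x
  separated {x} {y} x∼y reach with simpleWalk reach
  ... | []         , _    , stop                  = irrefl T x∼y
  ... | _ ∷ []     , _    , step (_ , ≢xy) stop   = ≢xy (inj₂ (refl , refl))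
  ... | u ∷ w ∷ us , uniq , walk                  =
    acyclic (y ∷ u ∷ w ∷ us) (s≤s (s≤s (s≤s z≤n)) , uniq , Walk⇒Linked proj₁ x∼y walk)

  Avoiding : Fin t → Fin t → Fin t → Set
  Avoiding x u v = u ∼ v × u ≢ x × v ≢ x

  avoiding⇒reachable : ∀ {x y u v} → Star (Avoiding x) u v → Reachable (deleteEdge T y x) u v
  avoiding⇒reachable = Star.map λ { (u∼v , u≢x , v≢x) →
    u∼v , λ { (inj₁ (_ , v≡x)) → v≢x v≡x ; (inj₂ (u≡x , _)) → u≢x u≡x } }

  avoiding-start : ∀ {x v} → Star (Avoiding x) x v → v ≡ x
  avoiding-start ε                   = refl
  avoiding-start ((_ , x≢x , _) ◅ _) = contradiction refl x≢x

  -- The walk is cut at its last visit to `x`, after which there is nothing or a step away from `x`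
  -- and a walk that never returns. A walk that does not meet `x` is kept whole.
  lastVisit : ∀ {R : Fin t → Fin t → Set} → (∀ {u v} → R u v → u ∼ v) → ∀ x {u v} → Star R u v →
    Star (Avoiding x) u v ⊎ v ≡ x ⊎ ∃[ w ] (R x w × Star (Avoiding x) w v)
  lastVisit R⊆∼ x ε = inj₁ ε
  lastVisit R⊆∼ x (_◅_ {u} {w} r rs) with lastVisit R⊆∼ x rs
  ... | inj₂ p = inj₂ p
  ... | inj₁ p with u ≟ᶠ x | w ≟ᶠ x
  ...   | yes refl | _        = inj₂ (inj₂ (w , r , p))
  ...   | no _     | yes refl = inj₂ (inj₁ (avoiding-start p))
  ...   | no u≢x   | no w≢x   = inj₁ ((R⊆∼ r , u≢x , w≢x) ◅ p)

  -- After its last visit to `x` the walk goes on through a neighbour `w`, which is not `y` as the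
  -- edge `xy` is deleted. So the side of `x` is covered by `x` and the branches at its other
  -- neighbours.
  beyond : ∀ {x y v} → Reachable (deleteEdge T x y) x v →
    v ≡ x ⊎ ∃[ w ] (x ∼ w × w ≢ y × Reachable (deleteEdge T w x) w v)
  beyond {x} reach with lastVisit proj₁ x reach
  ... | inj₁ p                          = inj₁ (avoiding-start p)
  ... | inj₂ (inj₁ v≡x)                 = inj₁ v≡x
  ... | inj₂ (inj₂ (w , (x∼w , ≢xy) , p)) =
    inj₂ (w , x∼w , (λ w≡y → ≢xy (inj₁ (refl , w≡y))) , avoiding⇒reachable p)

  -- Only the last passage over the edge `xy` matters: what follows it joins `x` or `y` to `v`.
  both-sides : ∀ x y {u v} → Reachable T u v → Reachable (deleteEdge T x y) u v ⊎
    (Reachable (deleteEdge T x y) x v ⊎ Reachable (deleteEdge T x y) y v)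
  both-sides x y ε = inj₁ ε
  both-sides x y (_◅_ {u} {w} u∼w rs) with both-sides x y rs
  ... | inj₂ p = inj₂ p
  ... | inj₁ p with ((u ≟ᶠ x) ×-dec (w ≟ᶠ y)) ⊎-dec ((u ≟ᶠ y) ×-dec (w ≟ᶠ x))
  ...   | yes (inj₁ (refl , refl)) = inj₂ (inj₂ p)
  ...   | yes (inj₂ (refl , refl)) = inj₂ (inj₁ p)
  ...   | no ≢xy                   = inj₁ ((u∼w , ≢xy) ◅ p)

  -- Branches shrink along the descent: the walk from `w` is prefixed by the step from `x` to `w`
  -- and, as it never meets `x`, does not use the edge `xy`.
  beyond-mono : ∀ {x y w} → x ∼ w → w ≢ y → ∀ {v} →
    Reachable (deleteEdge T w x) w v → Reachable (deleteEdge T x y) x v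
  beyond-mono {x} {y} {w} x∼w w≢y reach = (x∼w , xw≢xy) ◅ inside-w ε reach
    where
    xw≢xy : ¬ (x ≡ x × w ≡ y ⊎ x ≡ y × w ≡ x)
    xw≢xy (inj₁ (_ , w≡y)) = w≢y w≡y
    xw≢xy (inj₂ (_ , w≡x)) = ∼⇒≢ x∼w (sym w≡x)

    -- A walk from w that does not use the edge wx never meets x.
    inside-w : ∀ {u v} → Reachable (deleteEdge T w x) w u → Reachable (deleteEdge T w x) u v →
               Reachable (deleteEdge T x y) u v
    inside-w w⇝u ε = ε
    inside-w {u} w⇝u (_◅_ {j = u′} r rs) = (proj₁ r , avoids) ◅ inside-w w⇝u′ rs
      where
      w⇝u′ = w⇝u ◅◅ r ◅ ε
      ≢x : ∀ {z} → Reachable (deleteEdge T w x) w z → z ≢ x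
      ≢x p refl = separated x∼w (reachable-sym p)
      avoids : ¬ (u ≡ x × u′ ≡ y ⊎ u ≡ y × u′ ≡ x)
      avoids (inj₁ (u≡x , _))  = ≢x w⇝u u≡x
      avoids (inj₂ (_ , u′≡x)) = ≢x w⇝u′ u′≡x

-- Descent through a rank-decomposition

module Balance {n} (D : RankDecomposition n) where
  open RankDecomposition D
  open TreeProperties T isTree

  -- The descent is measured in nodes of the tree: `x` itself drops out at each step, whereas for
  -- `side` a strict decrease would need a leaf in the other branch.
  nodes : Fin t → Fin t → Subset t
  nodes x y = tabulate (does ∘ reachable? (deleteEdge T x y) x)

  neighbours : Fin t → Subset t
  neighbours x = tabulate (does ∘ adj? T x)

  ∈-side⁺ : ∀ {x y v} → Reachable (deleteEdge T x y) x (leaf v) → v ∈ side (x , y)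
  ∈-side⁺ = ∈-tabulate⁺ (reachable? _ _ ∘ leaf)

  ∈-side⁻ : ∀ {x y v} → v ∈ side (x , y) → Reachable (deleteEdge T x y) x (leaf v)
  ∈-side⁻ = ∈-tabulate⁻ (reachable? _ _ ∘ leaf)

  leaf-injective : ∀ {v w} → leaf v ≡ leaf w → v ≡ w
  leaf-injective = Bijection.injective L ∘ proj₁-injective
    where
    proj₁-injective : {l l′ : Leaf T} → proj₁ l ≡ proj₁ l′ → l ≡ l′
    proj₁-injective {x , p} {_ , q} refl = cong (x ,_) (ℕ.≡-irrelevant p q)

  leaf-degree : ∀ v → degree T (leaf v) ≡ 1
  leaf-degree v = proj₂ (Bijection.to L v)

  all-equal⇒∣p∣≤1 : (p : Subset n) → (∀ {v w} → v ∈ p → w ∈ p → v ≡ w) → ∣ p ∣ ≤ 1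
  all-equal⇒∣p∣≤1 p eq with nonempty? p
  ... | yes (v , v∈) = ℕ.≤-trans
    (p⊆q⇒∣p∣≤∣q∣ {q = ⁅ v ⁆} (λ w∈ → subst (_∈ ⁅ v ⁆) (eq v∈ w∈) (x∈⁅x⁆ v)))
    (ℕ.≤-reflexive (∣⁅x⁆∣≡1 v))
  ... | no ¬ne       = ℕ.≤-trans (ℕ.≤-reflexive (trans (cong ∣_∣ (Empty-unique ¬ne)) (∣⊥∣≡0 n))) z≤n

  -- A node of degree 1 has no neighbour besides `y`, so by `beyond` its side consists of `x` alone.
  ∣side∣≤1 : ∀ {x y} → x ∼ y → degree T x ≡ 1 → ∣ side (x , y) ∣ ≤ 1
  ∣side∣≤1 {x} {y} x∼y deg = all-equal⇒∣p∣≤1 (side (x , y)) λ v∈ w∈ →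
    leaf-injective (trans (only-x v∈) (sym (only-x w∈)))
    where
    only-x : ∀ {v} → v ∈ side (x , y) → leaf v ≡ x
    only-x v∈ with beyond (∈-side⁻ v∈)
    ... | inj₁ eq                  = eq
    ... | inj₂ (w , x∼w , w≢y , _) = contradiction
      (∣p∣≡1⇒unique (neighbours x) deg (∈-tabulate⁺ (adj? T x) x∼y) (∈-tabulate⁺ (adj? T x) x∼w)) w≢y

  -- A node of degree 3 is no leaf and carries no vertex of the graph, so the side is covered by the
  -- two branches other than `y`.
  descend : ∀ {x y} → x ∼ y → degree T x ≡ 3 → ∃₂ λ w z →
    (x ∼ w × w ≢ y) × (x ∼ z × z ≢ y) × ∣ side (x , y) ∣ ≤ ∣ side (w , x) ∣ + ∣ side (z , x) ∣
  descend {x} {y} x∼y deg with ∣p∣≡3⇒others (neighbours x) deg (∈-tabulate⁺ (adj? T x) x∼y)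
  ... | w , z , (w∈ , w≢y) , (z∈ , z≢y) , others =
    w , z , (∈-tabulate⁻ (adj? T x) w∈ , w≢y) , (∈-tabulate⁻ (adj? T x) z∈ , z≢y) ,
    covered⇒∣p∣≤ (side (x , y)) (side (w , x)) (side (z , x)) (cover ∘ beyond ∘ ∈-side⁻)
    where
    cover : ∀ {v} → leaf v ≡ x ⊎ ∃[ u ] (x ∼ u × u ≢ y × Reachable (deleteEdge T u x) u (leaf v)) →
            v ∈ side (w , x) ⊎ v ∈ side (z , x)
    cover {v} (inj₁ refl) = contradiction (trans (sym (leaf-degree v)) deg) λ ()
    cover (inj₂ (u , x∼u , u≢y , reach)) with others (∈-tabulate⁺ (adj? T x) x∼u) u≢y
    ... | inj₁ refl = inj₁ (∈-side⁺ reach)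
    ... | inj₂ refl = inj₂ (∈-side⁺ reach)

  nodes-⊂ : ∀ {x y w} → x ∼ w → w ≢ y → nodes w x ⊂ nodes x y
  nodes-⊂ {x} {y} {w} x∼w w≢y =
    (∈-tabulate⁺ (reachable? _ x) ∘ beyond-mono x∼w w≢y ∘ ∈-tabulate⁻ (reachable? _ w)) ,
    x , ∈-tabulate⁺ (reachable? (deleteEdge T x y) x) ε ,
    separated x∼w ∘ reachable-sym ∘ ∈-tabulate⁻ (reachable? (deleteEdge T w x) w)

  Heavy Balanced : Fin t → Fin t → Set
  Heavy x y    = x ∼ y × n ≤ 3 * ∣ side (x , y) ∣
  Balanced x y = Heavy x y × 3 * ∣ side (x , y) ∣ ≤ 2 * n

  -- If a heavy side is too large, `x` is not a leaf, as one vertex is at most 2n/3 for n ≥ 2. One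
  -- of its two branches is then heavy again, since two branches below n/3 could not make up more
  -- than 2n/3.
  heavy⇒balanced : 2 ≤ n → ∀ {x y} → Heavy x y → ∃₂ Balanced
  heavy⇒balanced 2≤n heavy = go heavy (<-wellFounded _)
    where
    3*1≤2*n : 3 * 1 ≤ 2 * n
    3*1≤2*n = ℕ.≤-trans (ℕ.n≤1+n 3) (ℕ.*-monoʳ-≤ 2 2≤n)

    go : ∀ {x y} → Heavy x y → Acc _<_ ∣ nodes x y ∣ → ∃₂ Balanced
    go {x} {y} heavy@(x∼y , _) (acc rs) with 3 * ∣ side (x , y) ∣ ℕ.≤? 2 * n | degrees x
    ... | yes light | _        = x , y , heavy , light
    ... | no ¬light | inj₁ deg = contradiction
      (ℕ.≤-trans (ℕ.*-monoʳ-≤ 3 (∣side∣≤1 x∼y deg)) 3*1≤2*n) ¬light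
    ... | no ¬light | inj₂ deg with descend x∼y deg
    ...   | w , z , (x∼w , w≢y) , (x∼z , z≢y) , ≤w+z
      with n ℕ.≤? 3 * ∣ side (w , x) ∣ | n ℕ.≤? 3 * ∣ side (z , x) ∣
    ...     | yes h | _     = go (symm T x∼w , h) (rs (p⊂q⇒∣p∣<∣q∣ (nodes-⊂ x∼w w≢y)))
    ...     | no _  | yes h = go (symm T x∼z , h) (rs (p⊂q⇒∣p∣<∣q∣ (nodes-⊂ x∼z z≢y)))
    ...     | no l  | no l′ = contradiction light ¬light
      where
      open ℕ.≤-Reasoning
      light : 3 * ∣ side (x , y) ∣ ≤ 2 * n
      light = begin
        3 * ∣ side (x , y) ∣                           ≤⟨ ℕ.*-monoʳ-≤ 3 ≤w+z ⟩
        3 * (∣ side (w , x) ∣ + ∣ side (z , x) ∣)      ≡⟨ ℕ.*-distribˡ-+ 3 ∣ side (w , x) ∣ ∣ side (z , x) ∣ ⟩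
        3 * ∣ side (w , x) ∣ + 3 * ∣ side (z , x) ∣    ≤⟨ ℕ.+-mono-≤ (ℕ.≰⇒≥ l) (ℕ.≰⇒≥ l′) ⟩
        n + n                                          ≡⟨ cong (λ s → n + s) (ℕ.+-identityʳ n) ⟨
        2 * n                                          ∎

  neighbour : ∀ x → ∃[ y ] x ∼ y
  neighbour x = nonempty⇒neighbour (degree-nonempty (degrees x))
    where
    degree-nonempty : degree T x ≡ 1 ⊎ degree T x ≡ 3 → Nonempty (neighbours x)
    degree-nonempty = [ ∣p∣≡suc⇒nonempty (neighbours x) , ∣p∣≡suc⇒nonempty (neighbours x) ]′
    nonempty⇒neighbour : Nonempty (neighbours x) → ∃[ y ] x ∼ y
    nonempty⇒neighbour (y , y∈) = y , ∈-tabulate⁻ (adj? T x) y∈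

  n≤sides : ∀ x y → n ≤ ∣ side (x , y) ∣ + ∣ side (y , x) ∣
  n≤sides x y = subst (_≤ ∣ side (x , y) ∣ + ∣ side (y , x) ∣) (∣⊤∣≡n n)
    (covered⇒∣p∣≤ ⊤ (side (x , y)) (side (y , x)) λ {v} _ →
      cover (both-sides x y (IsTree.connected isTree x (leaf v))))
    where
    cover : ∀ {v} → Reachable (deleteEdge T x y) x (leaf v) ⊎
              (Reachable (deleteEdge T x y) x (leaf v) ⊎ Reachable (deleteEdge T x y) y (leaf v)) →
            v ∈ side (x , y) ⊎ v ∈ side (y , x)
    cover (inj₁ p)        = inj₁ (∈-side⁺ p)
    cover (inj₂ (inj₁ p)) = inj₁ (∈-side⁺ p)
    cover (inj₂ (inj₂ p)) = inj₂ (∈-side⁺ (reachable-sym p))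

  someEdge : ∃₂ _∼_
  someEdge = go 2≤t
    where
    go : 2 ≤ t → ∃₂ _∼_
    go (s≤s _) = zero , neighbour zero

  -- The two sides of any edge cover all vertices, so at least one of them is heavy and starts the
  -- descent.
  balanced : 2 ≤ n → ∃₂ Balanced
  balanced 2≤n with someEdge
  ... | x , y , x∼y with n ℕ.≤? 3 * ∣ side (x , y) ∣
  ...   | yes h = heavy⇒balanced 2≤n (x∼y , h)
  ...   | no ¬h = heavy⇒balanced 2≤n (symm T x∼y , h)
    where
    open ℕ.≤-Reasoning
    a = ∣ side (x , y) ∣
    b = ∣ side (y , x) ∣
    h : n ≤ 3 * b
    h = ℕ.+-cancelˡ-≤ n n (3 * b) (begin
      n + n              ≤⟨ ℕ.+-mono-≤ (n≤sides x y) (n≤sides x y) ⟩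
      (a + b) + (a + b)  ≤⟨ ≤3 a b ⟩
      3 * a + 3 * b      ≤⟨ ℕ.+-monoˡ-≤ (3 * b) (ℕ.≰⇒≥ ¬h) ⟩
      n + 3 * b          ∎)
      where
      ≤3 : ∀ a b → (a + b) + (a + b) ≤ 3 * a + 3 * b
      ≤3 a b = ℕ.≤-trans (ℕ.m≤m+n _ (a + b)) (ℕ.≤-reflexive (eq a b))
        where
        eq : ∀ a b → (a + b) + (a + b) + (a + b) ≡ 3 * a + 3 * b
        eq = solve-∀

-- Cut-rank

∈-max : ∀ {x} xs → x ∈ˡ xs → x ≤ max 0 xs
∈-max xs = All.lookup (xs≤max 0 xs)

∈-subsets : ∀ {n} (S : Subset n) → S ∈ˡ subsets n
∈-subsets []            = here refl
∈-subsets (inside ∷ S)  = ∈-++⁺ˡ (∈-map⁺ (inside ∷_) (∈-subsets S))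
∈-subsets {suc n} (outside ∷ S) = ∈-++⁺ʳ (map (inside ∷_) (subsets n)) (∈-map⁺ (outside ∷_) (∈-subsets S))

∣independent∣≤rank : ∀ {p q} (A : Matrix p q) X Y S → S ⊆ X → LinearlyIndependent A Y S →
  ∣ S ∣ ≤ rank A X Y
∣independent∣≤rank A X Y S S⊆X ind = ∈-max _ (∈-map⁺ ∣_∣
  (∈-filter⁺ (λ S → S ⊆? X ×-dec linearlyIndependent? A Y S) (∈-subsets S) (S⊆X , ind)))

-- If all other terms were `false`, the sum would be `f i`.
sum≡false⇒another-true : ∀ {n} (f : Fin n → Bool) i → 𝔽₂.sum f ≡ false → f i ≡ true →
  ∃[ j ] (j ≢ i × f j ≡ true)
sum≡false⇒another-true {suc n} f i ∑≡false fi with any? (λ j → ¬? (j ≟ᶠ i) ×-dec (f j Bool.≟ true))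
... | yes found = found
... | no ¬found = contradiction (begin
    true                             ≡⟨ cong₂ _xor_ fi others ⟨
    f i xor 𝔽₂.sum (removeAt f i)    ≡⟨ 𝔽₂-Sum.sum-remove {i = i} f ⟨
    𝔽₂.sum f                         ≡⟨ ∑≡false ⟩
    false                            ∎) λ ()
  where
  open ≡-Reasoning
  vanishes : ∀ j → f (punchIn i j) ≡ false
  vanishes j = Bool.¬-not λ eq → ¬found (punchIn i j , punchInᵢ≢i i j , eq)
  others : 𝔽₂.sum (removeAt f i) ≡ false
  others = trans (𝔽₂-Sum.sum-cong-≗ vanishes) (𝔽₂-Sum.sum-replicate-zero n)

-- The columns partner u (u ∈ S) make A triangular when the rows are ordered by key.
triangular⇒independent : ∀ {p q} (A : Matrix p q) Y S (key : Fin p → ℕ) (partner : Fin p → Fin q) →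
  (∀ {u} → u ∈ S → partner u ∈ Y × A u (partner u) ≡ true) →
  (∀ {u w} → u ∈ S → A w (partner u) ≡ true → w ≢ u → key w < key u) →
  LinearlyIndependent A Y S
triangular⇒independent A Y S key partner diagonal below (R , R⊆S , (u , u∈R) , vanish) =
  go u u∈R (<-wellFounded (key u))
  where
  -- Infinite descent: the entry of row `u` in column `partner u` must be cancelled by that of
  -- another row `w` of `R`, which has a smaller key.
  go : ∀ u → u ∈ R → ¬ Acc _<_ (key u)
  go u u∈R (acc rs) with diagonal (R⊆S u∈R)
  ... | partner∈Y , Auu with sum≡false⇒another-true (λ x → lookup R x ∧ A x (partner u)) u
                               (vanish (partner u) partner∈Y) (cong₂ _∧_ ([]=⇒lookup u∈R) Auu)
  ... | w , w≢u , eq = go w w∈R (rs (below (R⊆S u∈R) Awu w≢u))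
    where
    ∧-true : ∀ a b → a ∧ b ≡ true → a ≡ true × b ≡ true
    ∧-true true b eq = refl , eq
    w∈R = lookup⇒[]= w R (proj₁ (∧-true _ _ eq))
    Awu = proj₂ (∧-true (lookup R w) _ eq)

-- A step along the path in a fixed sense, staying put at the end of the path.
record Direction (m : ℕ) : Set where
  field
    move     : Fin m → Fin m
    height   : Fin m → ℕ
    adjacent : ∀ a → move a ≢ a → Adj (path m) a (move a)
    lower    : ∀ a → move a ≢ a → height (move a) < height a
    backward : ∀ {a b} → move a ≢ a → Adj (path m) b (move a) → b ≢ a → height b < height a

downward : ∀ m → Direction m
downward m = record
  { move = pred ; height = toℕ ; adjacent = adjacent ; lower = lower ; backward = backward }
  where
  toℕ-pred : ∀ {m} (a : Fin m) → pred a ≢ a → toℕ a ≡ suc (toℕ (pred a))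
  toℕ-pred zero    ≢ = contradiction refl ≢
  toℕ-pred (suc a) ≢ = cong suc (sym (toℕ-inject₁ a))
  adjacent : ∀ a → pred a ≢ a → Adj (path m) a (pred a)
  adjacent a ≢ = inj₂ (toℕ-pred a ≢)
  lower : ∀ a → pred a ≢ a → toℕ (pred a) < toℕ a
  lower a ≢ = ℕ.≤-reflexive (sym (toℕ-pred a ≢))
  backward : ∀ {a b} → pred a ≢ a → Adj (path m) b (pred a) → b ≢ a → toℕ b < toℕ a
  backward {a} {b} ≢ (inj₁ eq) _ = ℕ.<-trans (ℕ.≤-reflexive (sym eq)) (lower a ≢)
  backward {a} {b} ≢ (inj₂ eq) b≢a = contradiction (toℕ-injective (trans eq (sym (toℕ-pred a ≢)))) b≢a

upward : ∀ m → Direction m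
upward m = record
  { move = up ; height = λ a → m ∸ toℕ a ; adjacent = adjacent ; lower = lower ; backward = backward }
  where
  toℕ-up : ∀ {m} (a : Fin m) → up a ≢ a → toℕ (up a) ≡ suc (toℕ a)
  toℕ-up {suc zero}    zero    ≢ = contradiction refl ≢
  toℕ-up {suc (suc m)} zero    ≢ = refl
  toℕ-up               (suc a) ≢ = cong suc (toℕ-up a (≢ ∘ cong suc))
  adjacent : ∀ a → up a ≢ a → Adj (path m) a (up a)
  adjacent a ≢ = inj₁ (toℕ-up a ≢)
  higher⇒lower : ∀ (a b : Fin m) → toℕ a < toℕ b → m ∸ toℕ b < m ∸ toℕ a
  higher⇒lower a b a<b = ℕ.∸-monoʳ-< a<b (ℕ.<⇒≤ (toℕ<n b))
  lower : ∀ a → up a ≢ a → m ∸ toℕ (up a) < m ∸ toℕ a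
  lower a ≢ = higher⇒lower a (up a) (ℕ.≤-reflexive (sym (toℕ-up a ≢)))
  backward : ∀ {a b} → up a ≢ a → Adj (path m) b (up a) → b ≢ a → m ∸ toℕ b < m ∸ toℕ a
  backward {a} {b} ≢ (inj₁ eq) b≢a = contradiction
    (toℕ-injective (ℕ.suc-injective (trans (sym eq) (toℕ-up a ≢)))) b≢a
  backward {a} {b} ≢ (inj₂ eq) _   = higher⇒lower a b
    (ℕ.<-trans (ℕ.≤-reflexive (sym (toℕ-up a ≢))) (ℕ.≤-reflexive (sym eq)))

funToFin-cong : ∀ {m n} {f g : Fin m → Fin n} → f ≗ g → funToFin f ≡ funToFin g
funToFin-cong {zero}  f≗g = refl
funToFin-cong {suc m} f≗g = cong₂ combine (f≗g zero) (funToFin-cong (f≗g ∘ suc))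

finToFun-injective : ∀ {m} k {u v : Fin (m ^ k)} → finToFun {m} {k} u ≗ finToFun v → u ≡ v
finToFun-injective {m} k {u} {v} u≗v =
  trans (sym (funToFin-finToFin {k} {m} u)) (trans (funToFin-cong u≗v) (funToFin-finToFin {k} {m} v))

encode-decode : ∀ m k (u : Fin (m ^ k)) → encode {m} {k} (decode u) ≡ u
encode-decode m k u = trans (funToFin-cong (lookup∘tabulate (finToFun {m} {k} u))) (funToFin-finToFin {k} {m} u)

-- Exits of a vertex set of the grid and its cut-rank

module Exits m k (X : Subset (m ^ k)) where

  member : Vec (Fin m) k → Bool
  member v = lookup X (encode v)

  count-member : count k member ≡ ∣ X ∣
  count-member = sym (trans (∣p∣≡sum X) (sum-encode k ([_]ᵇ ∘ lookup X)))

  module _ (d : Direction m) (i : Fin k) where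
    open Direction d

    exitSet : Subset (m ^ k)
    exitSet = tabulate (exit move i member ∘ decode)

    ∣exitSet∣ : ∣ exitSet ∣ ≡ count k (exit move i member)
    ∣exitSet∣ = begin
      ∣ exitSet ∣                              ≡⟨ ∣p∣≡sum exitSet ⟩
      sum ([_]ᵇ ∘ lookup exitSet)              ≡⟨ sum-encode k ([_]ᵇ ∘ lookup exitSet) ⟩
      ∑ᵛ k ([_]ᵇ ∘ lookup exitSet ∘ encode)    ≡⟨ ∑ᵛ-cong k (cong [_]ᵇ ∘ decoded) ⟩
      count k (exit move i member)             ∎
      where
      open ≡-Reasoning
      decoded : ∀ v → lookup exitSet (encode v) ≡ exit move i member v
      decoded v = trans (lookup∘tabulate (exit move i member ∘ decode) (encode v))
                        (cong (exit move i member) (decode-encode v))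

    partner : Fin (m ^ k) → Fin (m ^ k)
    partner u = encode (updateAt (decode u) i move)

    partner-moved : ∀ u → finToFun (partner u) i ≡ move (finToFun u i)
    partner-moved u = begin
      finToFun (partner u) i                      ≡⟨ finToFun-funToFin (lookup (updateAt (decode u) i move)) i ⟩
      lookup (updateAt (decode u) i move) i       ≡⟨ lookup∘updateAt i (decode u) ⟩
      move (lookup (decode u) i)                  ≡⟨ cong move (lookup∘tabulate (finToFun u) i) ⟩
      move (finToFun u i)                         ∎
      where open ≡-Reasoning

    partner-fixed : ∀ u {j} → j ≢ i → finToFun (partner u) j ≡ finToFun u j
    partner-fixed u {j} j≢i = begin
      finToFun (partner u) j                      ≡⟨ finToFun-funToFin (lookup (updateAt (decode u) i move)) j ⟩
      lookup (updateAt (decode u) i move) j       ≡⟨ lookup∘updateAt′ j i j≢i (decode u) ⟩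
      lookup (decode u) j                         ≡⟨ lookup∘tabulate (finToFun u) j ⟩
      finToFun u j                                ∎
      where open ≡-Reasoning

    ∈-exitSet⁻ : ∀ {u} → u ∈ exitSet → u ∈ X × partner u ∈ ∁ X
    ∈-exitSet⁻ {u} u∈ = inX , x∉p⇒x∈∁p λ p∈X → contradiction (trans (sym out) ([]=⇒lookup p∈X)) λ ()
      where
      split : ∀ a b → a ∧ not b ≡ true → a ≡ true × b ≡ false
      split true false eq = refl , refl
      both = split _ _ (trans (sym (lookup∘tabulate (exit move i member ∘ decode) u)) ([]=⇒lookup u∈))
      out : lookup X (partner u) ≡ false
      out = proj₂ both
      inX : u ∈ X
      inX = lookup⇒[]= u X (trans (cong (lookup X) (sym (encode-decode m k u))) (proj₁ both))

    -- If the move stayed put, `partner u` would be `u`, at once inside and outside `X`.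
    moves : ∀ {u} → u ∈ exitSet → move (finToFun u i) ≢ finToFun u i
    moves {u} u∈ eq with u∈X , p∈∁X ← ∈-exitSet⁻ u∈ =
      x∈∁p⇒x∉p p∈∁X (subst (_∈ X) (sym (finToFun-injective k stays)) u∈X)
      where
      stays : finToFun (partner u) ≗ finToFun u
      stays j with j ≟ᶠ i
      ... | yes refl = trans (partner-moved u) eq
      ... | no j≢i   = partner-fixed u j≢i

    -- Every neighbour `w` of `partner u` other than `u` itself has a smaller height in coordinate
    -- `i` than `u`, so ordering by this height makes the matrix triangular.
    exitSet-independent : LinearlyIndependent (adjacencyMatrix (grid k m)) (∁ X) exitSet
    exitSet-independent = triangular⇒independent (adjacencyMatrix (grid k m)) (∁ X) exitSet
      (λ u → height (finToFun u i)) partner diagonal below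
      where
      diagonal : ∀ {u} → u ∈ exitSet → partner u ∈ ∁ X × adjacencyMatrix (grid k m) u (partner u) ≡ true
      diagonal {u} u∈ = proj₂ (∈-exitSet⁻ u∈) , dec-true (adj? (grid k m) u (partner u))
        (i , subst (Adj (path m) (finToFun u i)) (sym (partner-moved u)) (adjacent _ (moves u∈)) ,
         λ j j≢i → sym (partner-fixed u j≢i))

      below : ∀ {u w} → u ∈ exitSet → adjacencyMatrix (grid k m) w (partner u) ≡ true → w ≢ u →
              height (finToFun w i) < height (finToFun u i)
      below {u} {w} u∈ A≡true w≢u with adj? (grid k m) w (partner u)
      ... | yes (j , adj , eq) with j ≟ᶠ i
      -- Here `w` shares coordinate `i` with `partner u`, which is one step lower than `u`.
      ...   | no j≢i   = subst (λ a → height a < height (finToFun u i))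
        (sym (trans (eq i (j≢i ∘ sym)) (partner-moved u))) (lower _ (moves u∈))
      -- Here `w` lies on the line through `u` in direction `i`, on the far side of `partner u`.
      ...   | yes refl = backward (moves u∈) (subst (Adj (path m) (finToFun w i)) (partner-moved u) adj)
        λ wᵢ≡uᵢ → w≢u (finToFun-injective k (agree wᵢ≡uᵢ))
        where
        agree : finToFun w i ≡ finToFun u i → finToFun w ≗ finToFun u
        agree wᵢ≡uᵢ j with j ≟ᶠ i
        ... | yes refl = wᵢ≡uᵢ
        ... | no j≢i   = trans (eq j j≢i) (partner-fixed u j≢i)

    count-exit≤cutRank : count k (exit move i member) ≤ cutRank (grid k m) X
    count-exit≤cutRank = subst (_≤ cutRank (grid k m) X) ∣exitSet∣
      (∣independent∣≤rank (adjacencyMatrix (grid k m)) X (∁ X) exitSet (proj₁ ∘ ∈-exitSet⁻) exitSet-independent)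

  -- In each of the `k` coordinates both senses contribute at most the cut-rank to `isoperimetry`;
  -- the factor 2 thus arising is cancelled against the 4.
  cutRank-isoperimetry : 2 * (∣ X ∣ * (m ^ k ∸ ∣ X ∣)) ≤ m ^ suc k * (k * cutRank (grid k m) X)
  cutRank-isoperimetry = ℕ.*-cancelˡ-≤ 2 (begin
    2 * (2 * (∣ X ∣ * (m ^ k ∸ ∣ X ∣)))
      ≡⟨ ℕ.*-assoc 2 2 (∣ X ∣ * (m ^ k ∸ ∣ X ∣)) ⟨
    4 * (∣ X ∣ * (m ^ k ∸ ∣ X ∣))
      ≡⟨ cong₂ (λ a b → 4 * (a * b)) count-member count-not ⟨
    4 * (count k member * count k (not ∘ member))
      ≤⟨ isoperimetry m k member ⟩
    m ^ suc k * sum (exits member)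
      ≤⟨ ℕ.*-monoʳ-≤ (m ^ suc k) (sum-mono-≤ λ i →
           ℕ.+-mono-≤ (count-exit≤cutRank (upward m) i) (count-exit≤cutRank (downward m) i)) ⟩
    m ^ suc k * sum {k} (λ _ → ρ + ρ)
      ≡⟨ cong (m ^ suc k *_) (sum-const k (ρ + ρ)) ⟩
    m ^ suc k * (k * (ρ + ρ))
      ≡⟨ rearrange (m ^ suc k) k ρ ⟩
    2 * (m ^ suc k * (k * ρ))
      ∎)
    where
    open ℕ.≤-Reasoning
    ρ = cutRank (grid k m) X
    count-not : count k (not ∘ member) ≡ m ^ k ∸ ∣ X ∣
    count-not = trans (sym (ℕ.m+n∸m≡n (count k member) (count k (not ∘ member))))
                      (cong₂ _∸_ (count+count-not k member) count-member)
    rearrange : ∀ M k r → M * (k * (r + r)) ≡ 2 * (M * (k * r))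
    rearrange = solve-∀

-- Width of rank-decompositions of the grid

cutRank≤width : ∀ {n} (G : Graph n) (D : RankDecomposition n) {x y} → Adj (RankDecomposition.T D) x y →
  cutRank G (RankDecomposition.side D (x , y)) ≤ RankDecomposition.width D G
cutRank≤width G D x∼y = ∈-max _ (∈-map⁺ (cutRank G ∘ RankDecomposition.side D)
  (∈-filter⁺ (λ { (x , y) → adj? (RankDecomposition.T D) x y })
    (∈-cartesianProduct⁺ (∈-allFin _) (∈-allFin _)) x∼y))

-- Put p = 3a - n and q = 2n - 3a, both non-negative with p + q = n. Then 3a = n + p and 3(n - a) =
-- n + q, and the product of these is 2n² + pq.
2n²≤9ab : ∀ n a → n ≤ 3 * a → 3 * a ≤ 2 * n → 2 * (n * n) ≤ 9 * (a * (n ∸ a))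
2n²≤9ab n a n≤3a 3a≤2n
  with p , n+p≡3a ← ℕ.m≤n⇒∃[o]m+o≡n n≤3a | q , 3a+q≡2n ← ℕ.m≤n⇒∃[o]m+o≡n 3a≤2n = begin
  2 * (n * n)                      ≤⟨ ℕ.m≤m+n (2 * (n * n)) (p * q) ⟩
  2 * (n * n) + p * q              ≡⟨ cong (λ s → n * n + s + p * q) (ℕ.+-identityʳ (n * n)) ⟩
  n * n + n * n + p * q            ≡⟨ cong (λ s → n * n + n * s + p * q) p+q≡n ⟨
  n * n + n * (p + q) + p * q      ≡⟨ expand n p q ⟨
  (n + p) * (n + q)                ≡⟨ cong₂ _*_ n+p≡3a n+q≡3b ⟩
  (3 * a) * (3 * b)                ≡⟨ nine a b ⟩
  9 * (a * b)                      ∎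
  where
  open ℕ.≤-Reasoning
  b = n ∸ a
  a≤n : a ≤ n
  a≤n = ℕ.*-cancelˡ-≤ 3 (ℕ.≤-trans 3a≤2n (ℕ.*-monoˡ-≤ n (ℕ.n≤1+n 2)))
  p+q≡n : p + q ≡ n
  p+q≡n = ℕ.+-cancelˡ-≡ n (p + q) n (trans (sym (ℕ.+-assoc n p q))
    (trans (cong (_+ q) n+p≡3a) (trans 3a+q≡2n (cong (λ s → n + s) (ℕ.+-identityʳ n)))))
  n+q≡3b : n + q ≡ 3 * b
  n+q≡3b = ℕ.+-cancelˡ-≡ (3 * a) (n + q) (3 * b) (begin-equality
    3 * a + (n + q)    ≡⟨ swap (3 * a) n q ⟩
    n + (3 * a + q)    ≡⟨ cong (λ s → n + s) 3a+q≡2n ⟩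
    3 * n              ≡⟨ cong (3 *_) (ℕ.m+[n∸m]≡n a≤n) ⟨
    3 * (a + b)        ≡⟨ ℕ.*-distribˡ-+ 3 a b ⟩
    3 * a + 3 * b      ∎)
    where
    swap : ∀ x y z → x + (y + z) ≡ y + (x + z)
    swap = solve-∀
  expand : ∀ n p q → (n + p) * (n + q) ≡ n * n + n * (p + q) + p * q
  expand = solve-∀
  nine : ∀ a b → (3 * a) * (3 * b) ≡ 9 * (a * b)
  nine = solve-∀

2≤m^1+k : ∀ {m} k → 3 ≤ m → 2 ≤ m ^ suc k
2≤m^1+k {m@(suc _)} k 3≤m =
  ℕ.≤-trans (ℕ.≤-trans (ℕ.n≤1+n 2) 3≤m) (ℕ.m≤m*n m (m ^ k) {{ℕ.m^n≢0 m k}})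

-- In the application `M` is m^k, `m * M` the number n of vertices, `a` the product |X| (n - |X|),
-- and `K` the dimension k + 1 times the cut-rank.
cancel-m²M : ∀ m M a K .{{m≢0 : NonZero m}} .{{M≢0 : NonZero M}} →
  2 * (m * M * (m * M)) ≤ 9 * a → 2 * a ≤ m * (m * M) * K → 4 * M ≤ 9 * K
cancel-m²M m M a K {{m≢0}} {{M≢0}} lower upper = ℕ.*-cancelˡ-≤ (m * (m * M)) {{m²M≢0}} (begin
  m * (m * M) * (4 * M)            ≡⟨ square m M ⟩
  2 * (2 * (m * M * (m * M)))      ≤⟨ ℕ.*-monoʳ-≤ 2 lower ⟩
  2 * (9 * a)                      ≡⟨ swap 2 9 a ⟩
  9 * (2 * a)                      ≤⟨ ℕ.*-monoʳ-≤ 9 upper ⟩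
  9 * (m * (m * M) * K)            ≡⟨ swap 9 (m * (m * M)) K ⟩
  m * (m * M) * (9 * K)            ∎)
  where
  open ℕ.≤-Reasoning
  m²M≢0 : NonZero (m * (m * M))
  m²M≢0 = ℕ.m*n≢0 m (m * M) {{m≢0}} {{ℕ.m*n≢0 m M {{m≢0}} {{M≢0}}}}
  square : ∀ m M → m * (m * M) * (4 * M) ≡ 2 * (2 * (m * M * (m * M)))
  square = solve-∀
  swap : ∀ a b c → a * (b * c) ≡ b * (a * c)
  swap = solve-∀

cutRank-balanced : ∀ k m .{{_ : NonZero m}} (X : Subset (m ^ suc k)) →
  m ^ suc k ≤ 3 * ∣ X ∣ → 3 * ∣ X ∣ ≤ 2 * m ^ suc k → 4 * m ^ k ≤ 9 * (suc k * cutRank (grid (suc k) m) X)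
cutRank-balanced k m {{m≢0}} X n≤3s 3s≤2n =
  cancel-m²M m (m ^ k) (∣ X ∣ * (m ^ suc k ∸ ∣ X ∣)) (suc k * cutRank (grid (suc k) m) X)
    {{m≢0}} {{ℕ.m^n≢0 m k {{m≢0}}}}
    (2n²≤9ab (m ^ suc k) ∣ X ∣ n≤3s 3s≤2n) (Exits.cutRank-isoperimetry m (suc k) X)

balanced-cut : ∀ {n} (G : Graph n) (D : RankDecomposition n) → 2 ≤ n →
  ∃[ X ] (n ≤ 3 * ∣ X ∣ × 3 * ∣ X ∣ ≤ 2 * n × cutRank G X ≤ RankDecomposition.width D G)
balanced-cut G D 2≤n =
  let x , y , (x∼y , n≤3s) , 3s≤2n = Balance.balanced D 2≤n
  in RankDecomposition.side D (x , y) , n≤3s , 3s≤2n , cutRank≤width G D x∼y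

grid-width : ∀ k m .{{_ : NonZero m}} → 2 ≤ m ^ suc k → (D : RankDecomposition (m ^ suc k)) →
  4 * m ^ k ≤ 9 * (suc k * RankDecomposition.width D (grid (suc k) m))
grid-width k m 2≤n D =
  let X , n≤3s , 3s≤2n , ρ≤w = balanced-cut (grid (suc k) m) D 2≤n
  in ℕ.≤-trans (cutRank-balanced k m X n≤3s 3s≤2n) (ℕ.*-monoʳ-≤ 9 (ℕ.*-monoʳ-≤ (suc k) ρ≤w))

corollary6 : ∀ (k m : ℕ) .{{_ : NonZero k}} → 2 ≤ k → 3 ≤ m →
    ∀ (rw : ℕ) → IsRankWidth (grid k m) rw →
    (e *ᴿ ln3 *ᴿ fromℚ (+ 1 / 12)) *ᴿ fromℚ (+ (m ^ (k ∸ 1)) / k) ≤ᴿ fromℕ rw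
-- The threshold index is 0, because every term of the sequence on the left is at most `rw`.
corollary6 k@(suc k-1) m 2≤k 3≤m rw ((D , width≡rw) , _) δ 0<δ = 0 , λ i _ → begin
  seq (e *ᴿ ln3 *ᴿ fromℚ (+ 1 / 12)) i ℚ.* c
    ≤⟨ ℚ.*-monoʳ-≤-nonNeg c {{ℚ.normalize-nonNeg (m ^ k-1) k}} (e*ln3/12≤4/9 i) ⟩
  + 4 / 9 ℚ.* c
    ≡⟨ /-* 4 9 (m ^ k-1) k ⟩
  + (4 * m ^ k-1) / (9 * k)
    -- This is `grid-width` for a decomposition `D` of minimum width, with the denominators cleared.
    ≤⟨ /-mono-≤ (4 * m ^ k-1) (9 * k) rw 1
         (cross-multiplied rw (subst (λ w → 4 * m ^ k-1 ≤ 9 * (k * w)) width≡rw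
           (grid-width k-1 m {{ℕ.>-nonZero (ℕ.≤-trans (s≤s z≤n) 3≤m)}} (2≤m^1+k k-1 3≤m) D))) ⟩
  + rw / 1
    ≡⟨ ℚ.+-identityʳ (+ rw / 1) ⟨
  + rw / 1 ℚ.+ 0ℚ
    ≤⟨ ℚ.+-monoʳ-≤ (+ rw / 1) (ℚ.<⇒≤ 0<δ) ⟩
  + rw / 1 ℚ.+ δ ∎
  where
  open ℚ.≤-Reasoning
  c = + (m ^ k-1) / k
  rearrange : ∀ k w → 9 * (k * w) ≡ w * (9 * k)
  rearrange = solve-∀
  cross-multiplied : ∀ w → 4 * m ^ k-1 ≤ 9 * (k * w) → 4 * m ^ k-1 * 1 ≤ w * (9 * k)
  cross-multiplied w 4M≤9kw = ℕ.≤-trans (ℕ.≤-reflexive (ℕ.*-identityʳ (4 * m ^ k-1)))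
    (ℕ.≤-trans 4M≤9kw (ℕ.≤-reflexive (rearrange k w)))
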